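{- The smallest alphabet on which there exists an infinite word $w$ such that both $w$ and its curling-number transform $C(w)$ are overlap-free has size $4$. That is, such an infinite word exists over an alphabet of size $4$, and no such infinite word exists over any alphabet of size less than $4$.
   Context: Words are indexed from $0$; infinite words are one-sided, $w = w[0]w[1]\cdots$; $x[i..j]$ denotes the factor (contiguous block) $x[i]\cdots x[j]$. An overlap is a word of the form $a x a x a$ with $a$ a single letter and $x$ a possibly empty word; a word is overlap-free if it contains no overlap as a factor. The curling number of a nonempty finite word $u$ is the largest integer $k \ge 1$ such that $u = y z^k$ for some (possibly empty) word $y$ and some nonempty word $z$. For a finite or infinite word $x$, the curling-number transform $C(x)$ is the word over the positive integers, of the same length as $x$, whose $i$-th letter $C(x)[i]$ is the curling number of the prefix $x[0..i]$. The alphabet size refers to the alphabet of $w$, not of $C(w)$. -}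

module Defs where

open import Data.List.Base using (List; []; _∷_; _++_; [_]; length; take; concat; replicate; applyUpTo)
open import Data.List.Properties using (≡-dec; ++-identityʳ; ∷-injectiveʳ; length-++; length-++-≤ˡ; length-++-≤ʳ)
open import Data.Nat.Base using (ℕ; zero; suc; _+_; _∸_; _≤_; z≤n; s≤s)
open import Data.Nat.Properties using (≤-trans; ≤-reflexive; +-mono-≤; m≤n⇒m<n∨m≡n; anyUpTo?)
open import Data.Product.Base using (∃; ∃₂; _×_; _,_; proj₁)
open import Data.Sum.Base using (inj₁; inj₂)
open import Level using (Level)
open import Relation.Binary.Definitions using (DecidableEquality)
open import Relation.Binary.PropositionalEquality using (_≡_; _≢_; refl; cong; sym)
open import Relation.Nullary using (¬_; Dec; yes; no; contradiction)
open import Relation.Unary using (Pred; Decidable)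

private
  variable
    a : Level
    A : Set a

InfiniteWord : Set a → Set a
InfiniteWord A = ℕ → A

-- The factor w[i] ⋯ w[j], both ends included; empty when j < i.
_[_⋯_] : InfiniteWord A → ℕ → ℕ → List A
w [ i ⋯ j ] = applyUpTo (λ t → w (i + t)) (suc j ∸ i)

IsOverlap : List A → Set _
IsOverlap {A = A} u =
  ∃₂ λ (c : A) (x : List A) → u ≡ [ c ] ++ x ++ [ c ] ++ x ++ [ c ]

OverlapFree : InfiniteWord A → Set _
OverlapFree w = ∀ i j → ¬ IsOverlap (w [ i ⋯ j ])

infixr 8 _^^_

_^^_ : List A → ℕ → List A
z ^^ k = concat (replicate k z)

HasPowerSuffix : List A → ℕ → Set _
HasPowerSuffix {A = A} u k =
  ∃₂ λ (y z : List A) → z ≢ [] × u ≡ y ++ z ^^ k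

IsCurlingNumber : List A → ℕ → Set _
IsCurlingNumber u k =
  (1 ≤ k × HasPowerSuffix u k) × (∀ j → 1 ≤ j → HasPowerSuffix u j → j ≤ k)

private
  1≤length : (z : List A) → z ≢ [] → 1 ≤ length z
  1≤length []      z≢[] = contradiction refl z≢[]
  1≤length (_ ∷ _) _    = s≤s z≤n

  k≤length-^^ : (z : List A) → z ≢ [] → ∀ k → k ≤ length (z ^^ k)
  k≤length-^^ z z≢[] zero    = z≤n
  k≤length-^^ z z≢[] (suc k) =
    ≤-trans (+-mono-≤ (1≤length z z≢[]) (k≤length-^^ z z≢[] k))
            (≤-reflexive (sym (length-++ z)))

  exponent≤length : (u : List A) → ∀ k → HasPowerSuffix u k → k ≤ length u
  exponent≤length u k (y , z , z≢[] , refl) =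
    ≤-trans (k≤length-^^ z z≢[] k) (length-++-≤ʳ (z ^^ k) {y})

  take-length-++ : (xs ys : List A) → take (length xs) (xs ++ ys) ≡ xs
  take-length-++ []       ys = refl
  take-length-++ (x ∷ xs) ys = cong (x ∷_) (take-length-++ xs ys)

  greatest : ∀ {p} {P : Pred ℕ p} → Decidable P → ∀ n → (∀ j → P j → j ≤ n) →
             P 1 → ∃ λ k → (1 ≤ k × P k) × (∀ j → 1 ≤ j → P j → j ≤ k)
  greatest P? zero    bound p₁ = contradiction (bound 1 p₁) λ ()
  greatest {P = P} P? (suc n) bound p₁ with P? (suc n)
  ... | yes p = suc n , (s≤s z≤n , p) , λ j _ → bound j
  ... | no ¬p = greatest P? n bound′ p₁
    where
    bound′ : ∀ j → P j → j ≤ n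
    bound′ j pj with m≤n⇒m<n∨m≡n (bound j pj)
    ... | inj₁ (s≤s j≤n) = j≤n
    ... | inj₂ refl      = contradiction pj ¬p

module _ {A : Set a} (_≟_ : DecidableEquality A) where

  private
    IsPower : List A → ℕ → Set _
    IsPower u k = ∃ λ (z : List A) → z ≢ [] × u ≡ z ^^ k

    isPower? : ∀ c u k → Dec (IsPower (c ∷ u) k)
    isPower? c u zero    = no λ { (_ , _ , ()) }
    isPower? c u (suc k)
      with anyUpTo? (λ n → ≡-dec _≟_ (c ∷ u) ((c ∷ take n u) ^^ suc k)) (suc (length u))
    ... | yes (n , _ , eq) = yes (c ∷ take n u , (λ ()) , eq)
    ... | no  ¬any         = no λ
      { ([]    , z≢[] , _)    → z≢[] refl
      ; (_ ∷ z , _    , refl) → ¬any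
          ( length z
          , s≤s (length-++-≤ˡ z)
          , cong (λ t → (c ∷ t) ^^ suc k) (sym (take-length-++ z ((c ∷ z) ^^ k)))
          )
      }

    hasPowerSuffix⁺? : ∀ u k → Dec (HasPowerSuffix u (suc k))
    hasPowerSuffix⁺? []      k = no λ p → contradiction (exponent≤length [] (suc k) p) λ ()
    hasPowerSuffix⁺? (c ∷ u) k with isPower? c u (suc k) | hasPowerSuffix⁺? u k
    ... | yes (z , z≢[] , eq) | _ = yes ([] , z , z≢[] , eq)
    ... | no _  | yes (y , z , z≢[] , eq) = yes (c ∷ y , z , z≢[] , cong (c ∷_) eq)
    ... | no ¬p | no ¬q = no λ
      { ([]    , z , z≢[] , eq) → ¬p (z , z≢[] , eq)
      ; (_ ∷ y , z , z≢[] , eq) → ¬q (y , z , z≢[] , ∷-injectiveʳ eq)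
      }

    hasPowerSuffix? : ∀ u → u ≢ [] → Decidable (HasPowerSuffix u)
    hasPowerSuffix? u u≢[] zero    = yes (u , u , u≢[] , sym (++-identityʳ u))
    hasPowerSuffix? u u≢[] (suc k) = hasPowerSuffix⁺? u k

  curlingNumber : ∀ u → u ≢ [] → ∃ (IsCurlingNumber u)
  curlingNumber u u≢[] =
    greatest (hasPowerSuffix? u u≢[]) (length u) (exponent≤length u)
             ([] , u , u≢[] , sym (++-identityʳ u))

  C : InfiniteWord A → InfiniteWord ℕ
  C w i = proj₁ (curlingNumber (w [ 0 ⋯ i ]) λ ())

{-# OPTIONS --safe #-}

-- In an overlap-free word w the curling numbers are 1 and 2, and C(w)[n] = 2 exactly when a square
-- ends at n. Below four letters, a backtracking search over the prefixes of w refutes every word.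
-- On four letters, let t be the Thue-Morse word: w concatenates blocks of length 16, the j-th being
-- determined by t[j..j+2], chosen such that a short square ends at a position exactly when the
-- corresponding letter of t is 1. The blocks synchronize, so that a long square of w has a period
-- 16 q and projects to an overlap of period q in t. Hence w is overlap-free and C(w) is a suffix
-- of t up to renaming letters.
module Submission where

open import Defs
open import Data.Fin using (Fin; _≟_)
open import Data.Nat using (ℕ; _<_)
open import Data.Product using (∃; _×_)
open import Relation.Nullary using (¬_)

open import Data.Bool.Base using (Bool; true; false; not; _xor_; if_then_else_; _∧_; _∨_)
open import Data.Bool.ListAction using (any; all)
import Data.Bool.Properties as Bool
open import Data.Empty using (⊥)
open import Data.Fin.Base using (toℕ; inject≤)
open import Data.Fin.Patterns using (0F; 1F; 2F; 3F)
import Data.Fin.Properties as Fin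
open import Data.List.Base
  using (List; []; _∷_; _++_; [_]; length; drop; take; applyUpTo; applyDownFrom)
open import Data.List.Membership.Propositional using (_∈_)
import Data.List.Properties as List
open import Data.List.Properties
  using (length-applyUpTo; length-applyDownFrom; length-take; length-++; ++-assoc; ++-identityʳ;
         ∷-injectiveˡ; ∷-injectiveʳ)
open import Data.List.Relation.Unary.Any using (here; there)
open import Data.Nat.Base
  using (zero; suc; _+_; _*_; _^_; _∸_; _≤_; z≤n; s≤s; z<s; s<s; _≡ᵇ_; ⌊_/2⌋)
open import Data.Nat.Divisibility using (n∣m*n)
open import Data.Nat.DivMod
  using (_/_; _%_; _mod_; m≡m%n+[m/n]*n; m%n<n; m<n⇒m%n≡m; m<n⇒m/n≡0; m*n/n≡m; [m+kn]%n≡m%n;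
         +-distrib-/-∣ʳ)
open import Data.Nat.Induction using (<-wellFounded)
open import Data.Nat.Properties hiding (_≟_)
open import Algebra.Properties.CommutativeSemigroup +-commutativeSemigroup
  using (x∙yz≈y∙xz; xy∙z≈xz∙y)
open import Data.Product.Base using (∃₂; _,_; proj₁; proj₂)
open import Data.Sum.Base using (_⊎_; inj₁; inj₂)
open import Data.Unit.Base using (⊤; tt)
open import Data.Vec.Base using (Vec; []; _∷_; lookup; toList)
open import Function.Base using (_∘_)
open import Induction.WellFounded using (Acc; acc)
open import Level using (Level)
open import Relation.Binary.Definitions using (DecidableEquality)
open import Relation.Binary.PropositionalEquality
  using (_≡_; _≢_; refl; sym; trans; cong; cong₂; subst; subst₂; module ≡-Reasoning)
open import Relation.Nullary
  using (Dec; yes; no; does; _because_; contradiction; from-yes; map′; ¬?; _→-dec_; _×-dec_;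
         Reflects; ofʸ; ofⁿ)
open import Relation.Nullary.Reflects using (det)

-- Overlap-freeness of w alone contradicts nothing, as infinite overlap-free words exist already on
-- two letters. The search dies because C(w) must be overlap-free too, and such binary words are
-- few. Each partial word therefore carries the tree of its admissible transforms: its next letter
-- must complete a square where the tree prescribes 2 and must not where it prescribes 1.
--
-- On four letters, the word that drives the blocks is also the word to be realized. Since t is
-- fixed by the Thue-Morse morphism, its 16 letters from a multiple of 16 on are determined by one
-- letter; a block depends on the letter whose image it realizes and on the two neighbours of that
-- letter. The same fixed point makes every statement of bounded range about w finite: three letters
-- of t generate 160 letters of w, so that all positions fall into 8 * 64 cases settled by
-- computation. Only squares of long period need an argument.

private
  variable
    ℓ : Level
    A : Set ℓ

-- Overlaps, squares and curling numbers in terms of positions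

Agree : InfiniteWord A → ℕ → ℕ → ℕ → Set _
Agree w i j l = ∀ k → k < l → w (k + i) ≡ w (k + j)

-- The overlap axaxa with x of length `p` amounts to two occurrences of axa, which has `2 + p`
-- letters, at distance `suc p`. Taking `suc p` for the period keeps periods positive without a side
-- condition.
NoOverlap : InfiniteWord A → Set _
NoOverlap w = ∀ p i → ¬ Agree w i (suc p + i) (2 + p)

SquareSuffix : InfiniteWord A → ℕ → Set _
SquareSuffix w n = ∃₂ λ p i → suc p + (suc p + i) ≡ n × Agree w i (suc p + i) (suc p)

SquareEndsAt : InfiniteWord A → ℕ → Set _
SquareEndsAt w n = SquareSuffix w (suc n)

module _ {A : Set ℓ} where

  applyUpTo-cong : ∀ {f g : ℕ → A} l → (∀ k → k < l → f k ≡ g k) →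
                   applyUpTo f l ≡ applyUpTo g l
  applyUpTo-cong zero    f≗g = refl
  applyUpTo-cong (suc l) f≗g =
    cong₂ _∷_ (f≗g 0 z<s) (applyUpTo-cong l λ k k<l → f≗g (suc k) (s<s k<l))

  applyUpTo-injective : ∀ {f g : ℕ → A} l → applyUpTo f l ≡ applyUpTo g l →
                        ∀ k → k < l → f k ≡ g k
  applyUpTo-injective (suc l) eq zero    _         = ∷-injectiveˡ eq
  applyUpTo-injective (suc l) eq (suc k) (s<s k<l) =
    applyUpTo-injective l (∷-injectiveʳ eq) k k<l

  applyUpTo-++ : ∀ (f : ℕ → A) m n →
                 applyUpTo f (m + n) ≡ applyUpTo f m ++ applyUpTo (f ∘ (m +_)) n
  applyUpTo-++ f zero    n = refl
  applyUpTo-++ f (suc m) n = cong (f 0 ∷_) (applyUpTo-++ (f ∘ suc) m n)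

  applyUpTo-factor : ∀ (f : ℕ → A) {n} y x r → applyUpTo f n ≡ y ++ x ++ r →
                     x ≡ applyUpTo (f ∘ (length y +_)) (length x)
  applyUpTo-factor f {suc n} (_ ∷ y) x  r eq =
    applyUpTo-factor (f ∘ suc) y x r (∷-injectiveʳ eq)
  applyUpTo-factor f {suc n} [] (_ ∷ x) r eq =
    cong₂ _∷_ (sym (∷-injectiveˡ eq)) (applyUpTo-factor (f ∘ suc) [] x r (∷-injectiveʳ eq))
  applyUpTo-factor f {zero}  [] []      r eq = refl
  applyUpTo-factor f {suc n} [] []      r eq = refl

  factor-agree : ∀ (f : ℕ → A) {n} y y′ x r r′ →
                 applyUpTo f n ≡ y ++ x ++ r → applyUpTo f n ≡ y′ ++ x ++ r′ →
                 Agree f (length y) (length y′) (length x)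
  factor-agree f y y′ x r r′ eq eq′ k k<l = begin
    f (k + length y)  ≡⟨ cong f (+-comm k (length y)) ⟩
    f (length y + k)  ≡⟨ applyUpTo-injective (length x)
                           (trans (sym (applyUpTo-factor f y x r eq))
                                  (applyUpTo-factor f y′ x r′ eq′)) k k<l ⟩
    f (length y′ + k) ≡⟨ cong f (+-comm (length y′) k) ⟩
    f (k + length y′) ∎
    where open ≡-Reasoning

  Agree-≤ : ∀ {w : InfiniteWord A} {i j l m} → l ≤ m → Agree w i j m → Agree w i j l
  Agree-≤ l≤m agree k k<l = agree k (≤-trans k<l l≤m)

  agree⇒≡ : ∀ (w : InfiniteWord A) i j l → Agree w i j l →
            applyUpTo (w ∘ (i +_)) l ≡ applyUpTo (w ∘ (j +_)) l
  agree⇒≡ w i j l agree = applyUpTo-cong l λ k k<l →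
    trans (cong w (+-comm i k)) (trans (agree k k<l) (cong w (+-comm k j)))

  overlapFree⇒noOverlap : ∀ (w : InfiniteWord A) → OverlapFree w → NoOverlap w
  overlapFree⇒noOverlap w free p i agree =
    free i (i + (suc p + suc p)) (f 0 , applyUpTo (f ∘ suc) p , (begin
      applyUpTo f (suc (i + (suc p + suc p)) ∸ i)
        ≡⟨ cong (applyUpTo f) (trans (cong (_∸ i) (sym (+-suc i _))) (m+n∸m≡n i _)) ⟩
      applyUpTo f (suc (suc p + suc p))
        ≡⟨ cong (applyUpTo f) (sym (+-suc (suc p) (suc p))) ⟩
      applyUpTo f (suc p + (2 + p))
        ≡⟨ applyUpTo-++ f (suc p) (2 + p) ⟩
      z ++ applyUpTo (f ∘ (suc p +_)) (2 + p)
        ≡⟨ cong (z ++_) (applyUpTo-cong (2 + p) shift) ⟩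
      z ++ applyUpTo f (2 + p)
        ≡⟨ cong (λ l → z ++ applyUpTo f l) (+-comm 1 (suc p)) ⟩
      z ++ applyUpTo f (suc p + 1)
        ≡⟨ cong (z ++_) (applyUpTo-++ f (suc p) 1) ⟩
      z ++ z ++ [ f (suc p + 0) ]
        ≡⟨ cong (λ a → z ++ z ++ [ a ]) (shift 0 z<s) ⟩
      z ++ z ++ [ f 0 ] ∎))
    where
    open ≡-Reasoning
    f : ℕ → A
    f t = w (i + t)
    z = applyUpTo f (suc p)
    shift : ∀ k → k < 2 + p → f (suc p + k) ≡ f k
    shift k k<l = begin
      w (i + (suc p + k)) ≡⟨ cong w (trans (sym (+-assoc i (suc p) k))
                                      (trans (+-comm (i + suc p) k) (cong (k +_) (+-comm i (suc p))))) ⟩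
      w (k + (suc p + i)) ≡⟨ sym (agree k k<l) ⟩
      w (k + i)           ≡⟨ cong w (+-comm k i) ⟩
      w (i + k)           ∎

  noOverlap⇒overlapFree : ∀ (w : InfiniteWord A) → NoOverlap w → OverlapFree w
  noOverlap⇒overlapFree w free i j (c , x , eq) = free (length x) i λ k k<l → begin
    w (k + i)                    ≡⟨ cong w (+-comm k i) ⟩
    f k                          ≡⟨ cong f (sym (+-identityʳ k)) ⟩
    f (k + 0)                    ≡⟨ factor-agree f [] (c ∷ x) (c ∷ x ++ [ c ]) (x ++ [ c ]) []
                                      (trans eq (sym (++-assoc (c ∷ x) [ c ] (x ++ [ c ]))))
                                      (trans eq (cong ((c ∷ x) ++_) (sym (++-identityʳ (c ∷ x ++ [ c ])))))
                                      k (subst (k <_) (cong suc (sym (trans (length-++ x) (+-comm (length x) 1)))) k<l) ⟩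
    f (k + suc (length x))       ≡⟨ cong w (trans (+-comm i _) (+-assoc k _ i)) ⟩
    w (k + (suc (length x) + i)) ∎
    where
    open ≡-Reasoning
    f : ℕ → A
    f t = w (i + t)

  squareEndsAt⇒hasPowerSuffix : ∀ (w : InfiniteWord A) n → SquareEndsAt w n →
                                HasPowerSuffix (w [ 0 ⋯ n ]) 2
  squareEndsAt⇒hasPowerSuffix w n (p , i , end , agree) =
    applyUpTo w i , z , (λ ()) , (begin
      applyUpTo w (suc n)
        ≡⟨ cong (applyUpTo w) (sym end) ⟩
      applyUpTo w (suc p + (suc p + i))
        ≡⟨ cong (applyUpTo w) (trans (sym (+-assoc (suc p) (suc p) i)) (+-comm _ i)) ⟩
      applyUpTo w (i + (suc p + suc p))
        ≡⟨ applyUpTo-++ w i _ ⟩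
      y ++ applyUpTo (w ∘ (i +_)) (suc p + suc p)
        ≡⟨ cong (y ++_) (applyUpTo-++ (w ∘ (i +_)) (suc p) (suc p)) ⟩
      y ++ z ++ applyUpTo (w ∘ (i +_) ∘ (suc p +_)) (suc p)
        ≡⟨ cong (λ t → y ++ z ++ t) (applyUpTo-cong (suc p) λ k _ →
             cong w (trans (sym (+-assoc i (suc p) k)) (cong (_+ k) (+-comm i (suc p))))) ⟩
      y ++ z ++ applyUpTo (w ∘ ((suc p + i) +_)) (suc p)
        ≡⟨ cong (λ t → y ++ z ++ t) (sym (agree⇒≡ w i (suc p + i) (suc p) agree)) ⟩
      y ++ z ++ z
        ≡⟨ cong (λ t → y ++ z ++ t) (sym (++-identityʳ z)) ⟩
      y ++ z ^^ 2 ∎)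
    where
    open ≡-Reasoning
    y = applyUpTo w i
    z = applyUpTo (w ∘ (i +_)) (suc p)

  hasPowerSuffix⇒squareEndsAt : ∀ (w : InfiniteWord A) n → HasPowerSuffix (w [ 0 ⋯ n ]) 2 →
                                SquareEndsAt w n
  hasPowerSuffix⇒squareEndsAt w n (y , []        , z≢[] , _)  = contradiction refl z≢[]
  hasPowerSuffix⇒squareEndsAt w n (y , z@(a ∷ x) , _    , eq) =
    length x , length y , end , subst (λ j → Agree w (length y) j (length z)) len-yz
      (factor-agree w y (y ++ z) z (z ++ []) [] eq (trans eq (sym (++-assoc y z (z ++ [])))))
    where
    open ≡-Reasoning
    len-yz : length (y ++ z) ≡ length z + length y
    len-yz = trans (length-++ y) (+-comm (length y) (length z))
    end : length z + (length z + length y) ≡ suc n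
    end = begin
      length z + (length z + length y) ≡⟨ cong (length z +_) (sym len-yz) ⟩
      length z + length (y ++ z)       ≡⟨ +-comm (length z) _ ⟩
      length (y ++ z) + length z       ≡⟨ sym (length-++ (y ++ z)) ⟩
      length ((y ++ z) ++ z)           ≡⟨ cong length (++-assoc y z z) ⟩
      length (y ++ z ++ z)             ≡⟨ cong (λ t → length (y ++ z ++ t)) (sym (++-identityʳ z)) ⟩
      length (y ++ z ^^ 2)             ≡⟨ cong length (sym eq) ⟩
      length (applyUpTo w (suc n))     ≡⟨ length-applyUpTo w (suc n) ⟩
      suc n                            ∎

  -- A cube of z agrees with its shift by z along two copies of z, and an overlap needs only one
  -- letter more than one copy.
  noOverlap⇒noCube : ∀ (w : InfiniteWord A) → NoOverlap w → ∀ n k →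
                     ¬ HasPowerSuffix (w [ 0 ⋯ n ]) (3 + k)
  noOverlap⇒noCube w free n k (y , []        , z≢[] , _)  = z≢[] refl
  noOverlap⇒noCube w free n k (y , z@(a ∷ x) , _    , eq) =
    free (length x) (length y) (Agree-≤ {w = w} bound
      (subst (λ j → Agree w (length y) j (length (z ++ z))) len-yz
        (factor-agree w y (y ++ z) (z ++ z) (z ++ r) r eq₁ eq₂)))
    where
    r = z ^^ k
    len-yz : length (y ++ z) ≡ length z + length y
    len-yz = trans (length-++ y) (+-comm (length y) (length z))
    eq₁ : applyUpTo w (suc n) ≡ y ++ (z ++ z) ++ z ++ r
    eq₁ = trans eq (cong (y ++_) (sym (++-assoc z z (z ++ r))))
    eq₂ : applyUpTo w (suc n) ≡ (y ++ z) ++ (z ++ z) ++ r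
    eq₂ = trans eq (trans (cong (λ t → y ++ z ++ t) (sym (++-assoc z z r)))
                          (sym (++-assoc y z ((z ++ z) ++ r))))
    bound : 2 + length x ≤ length (z ++ z)
    bound = ≤-trans (≤-trans (≤-reflexive (+-comm 1 (length z))) (+-monoʳ-≤ (length z) (s≤s z≤n)))
                    (≤-reflexive (sym (length-++ z)))

  -- Works for any `k` that meets the specification, so that the computation inside `C` never has to
  -- be unfolded.
  curlingNumber-reflects : ∀ (w : InfiniteWord A) → NoOverlap w → ∀ n {k} →
    IsCurlingNumber (w [ 0 ⋯ n ]) k →
    ∃ λ b → Reflects (SquareEndsAt w n) b × k ≡ (if b then 2 else 1)
  curlingNumber-reflects w free n {0} ((() , _) , _)
  curlingNumber-reflects w free n {1} (_ , greatest) = false , ofⁿ ¬square , refl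
    where
    ¬square : ¬ SquareEndsAt w n
    ¬square square with s≤s () ← greatest 2 (s≤s z≤n) (squareEndsAt⇒hasPowerSuffix w n square)
  curlingNumber-reflects w free n {2} ((_ , power) , _) =
    true , ofʸ (hasPowerSuffix⇒squareEndsAt w n power) , refl
  curlingNumber-reflects w free n {suc (suc (suc k))} ((_ , power) , _) =
    contradiction power (noOverlap⇒noCube w free n k)

  module _ (_≟_ : DecidableEquality A) where

    C-reflects : ∀ w → NoOverlap w → ∀ n →
                 ∃ λ b → Reflects (SquareEndsAt w n) b × C _≟_ w n ≡ (if b then 2 else 1)
    C-reflects w free n =
      curlingNumber-reflects w free n (proj₂ (curlingNumber _≟_ (w [ 0 ⋯ n ]) (λ ())))

-- Backtracking over words on three letters

any-true : ∀ {A : Set ℓ} (f : A → Bool) xs → any f xs ≡ true → ∃ λ x → x ∈ xs × f x ≡ true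
any-true f (x ∷ xs) eq with f x in fx
... | true  = x , here refl , fx
... | false with y , y∈xs , fy ← any-true f xs eq = y , there y∈xs , fy

module _ {A : Set ℓ} where

  Agree-suc : ∀ (w : InfiniteWord A) {i j l} → Agree w i j l → w (l + i) ≡ w (l + j) →
              Agree w i j (suc l)
  Agree-suc w agree eq k (s≤s k≤l) with m≤n⇒m<n∨m≡n k≤l
  ... | inj₁ k<l  = agree k k<l
  ... | inj₂ refl = eq

  -- The search stores prefixes with the last letter first: extending a word is a cons, and a square
  -- at the end is an agreement of the list with one of its tails.
  drop-applyDownFrom : ∀ (w : InfiniteWord A) p n →
    (∃ λ m → n ≡ p + m × drop p (applyDownFrom w n) ≡ applyDownFrom w m)
    ⊎ drop p (applyDownFrom w n) ≡ []
  drop-applyDownFrom w zero    n       = inj₁ (n , refl , refl)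
  drop-applyDownFrom w (suc p) zero    = inj₂ refl
  drop-applyDownFrom w (suc p) (suc n) with drop-applyDownFrom w p n
  ... | inj₁ (m , n≡p+m , eq) = inj₁ (m , cong suc n≡p+m , eq)
  ... | inj₂ eq               = inj₂ eq

  module _ (_≟_ : DecidableEquality A) where

    -- A list that ends too early counts as a disagreement, so `true` certifies all `l` letters,
    -- whereas conclusions from `false` need a bound on the lengths.
    prefixesAgree : ℕ → List A → List A → Bool
    prefixesAgree zero    xs       ys       = true
    prefixesAgree (suc l) (x ∷ xs) (y ∷ ys) = does (x ≟ y) ∧ prefixesAgree l xs ys
    prefixesAgree (suc l) _        _        = false

    prefixesAgree⇒agree : ∀ (w : InfiniteWord A) p l m n → n ≡ p + m →
      prefixesAgree l (applyDownFrom w n) (applyDownFrom w m) ≡ true →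
      ∃ λ i → m ≡ l + i × Agree w i (p + i) l
    prefixesAgree⇒agree w p zero    m       n       _  _  = m , refl , λ _ ()
    prefixesAgree⇒agree w p (suc l) zero    (suc _) eq ()
    prefixesAgree⇒agree w p (suc l) (suc m) zero    eq ()
    prefixesAgree⇒agree w p (suc l) (suc m) (suc n) eq t with w n ≟ w m
    ... | yes wn≡wm with prefixesAgree⇒agree w p l m n (suc-injective (trans eq (+-suc p m))) t
    ...   | i , refl , agree = i , refl , Agree-suc w agree (trans (sym wn≡wm) (cong w n≡))
      where
      n≡ : n ≡ l + (p + i)
      n≡ = begin
        n           ≡⟨ suc-injective (trans eq (+-suc p m)) ⟩
        p + (l + i) ≡⟨ sym (+-assoc p l i) ⟩
        p + l + i   ≡⟨ cong (_+ i) (+-comm p l) ⟩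
        l + p + i   ≡⟨ +-assoc l p i ⟩
        l + (p + i) ∎
        where open ≡-Reasoning

data Letter : Set where
  𝐚 𝐛 𝐜 : Letter

_==_ : Letter → Letter → Bool
𝐚 == 𝐚 = true
𝐛 == 𝐛 = true
𝐜 == 𝐜 = true
_ == _ = false

==-reflects : ∀ x y → Reflects (x ≡ y) (x == y)
==-reflects 𝐚 𝐚 = ofʸ refl
==-reflects 𝐚 𝐛 = ofⁿ λ ()
==-reflects 𝐚 𝐜 = ofⁿ λ ()
==-reflects 𝐛 𝐚 = ofⁿ λ ()
==-reflects 𝐛 𝐛 = ofʸ refl
==-reflects 𝐛 𝐜 = ofⁿ λ ()
==-reflects 𝐜 𝐚 = ofⁿ λ ()
==-reflects 𝐜 𝐛 = ofⁿ λ ()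
==-reflects 𝐜 𝐜 = ofʸ refl

data Verdict : Set where
  squareless square overlapping : Verdict

worse : Verdict → Verdict → Verdict
worse squareless  v           = v
worse square      overlapping = overlapping
worse square      _           = square
worse overlapping _           = overlapping

-- After `l` equal letters, the next pair decides: these are the letters just before the two halves
-- of a square, and their equality extends it to an overlap. If the square starts at the beginning
-- of the word, there is no such pair.
compare : ℕ → List Letter → List Letter → Verdict
compare zero    (x ∷ _)  (y ∷ _)  = if x == y then overlapping else square
compare zero    _        _        = square
compare (suc l) (x ∷ xs) (y ∷ ys) = if x == y then compare l xs ys else squareless
compare (suc l) _        _        = squareless

-- Compares xs with its tails of periods exceeding p. The last argument loses two letters
-- whenever the tail loses one, so that it bounds the periods by half its length.
verdict : ℕ → List Letter → List Letter → List Letter → Verdict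
verdict p xs (_ ∷ ys) (_ ∷ _ ∷ probe) = worse (compare (suc p) xs ys) (verdict (suc p) xs ys probe)
verdict p xs _        _               = squareless

-- The tree of the overlap-free continuations of a binary word: the candidates for C(w), with true
-- standing for curling number 2. A node has the subtree of true first.
data Trie : Set where
  dead stop : Trie
  node      : Trie → Trie → Trie

-- Each p stands for the period suc p. Minimal binary overlaps have periods 2^k and 3 * 2^k.
periods : List ℕ
periods = 0 ∷ 1 ∷ 2 ∷ 3 ∷ 5 ∷ 7 ∷ 11 ∷ 15 ∷ 23 ∷ 31 ∷ []

overlapEnds : List Bool → Bool
overlapEnds bs = any (λ p → prefixesAgree Bool._≟_ (2 + p) bs (drop (suc p) bs)) periods

trie : ℕ → List Bool → Trie
trie zero    bs = stop
trie (suc n) bs =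
  if overlapEnds bs then dead else node (trie n (true ∷ bs)) (trie n (false ∷ bs))

everyLetter : (Letter → Bool) → Bool
everyLetter f = f 𝐚 ∧ (f 𝐛 ∧ f 𝐜)

everyLetter-sound : ∀ f → everyLetter f ≡ true → ∀ x → f x ≡ true
everyLetter-sound f eq x with f 𝐚 in fa | f 𝐛 in fb | f 𝐜 in fc
everyLetter-sound f eq 𝐚 | true | true | true = fa
everyLetter-sound f eq 𝐛 | true | true | true = fb
everyLetter-sound f eq 𝐜 | true | true | true = fc

mutual
  refutes : Trie → List Letter → Bool
  refutes dead          xs = true
  refutes stop          xs = false
  refutes (node dead f) xs = refutesFalse f xs
  refutes (node t    f) xs = everyLetter λ x → resolve t f (x ∷ xs)

  -- When only false can follow, every square refutes, and it suffices to look for short ones.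
  refutesFalse : Trie → List Letter → Bool
  refutesFalse dead xs = true
  refutesFalse f    xs = everyLetter λ x → resolveFalse f (x ∷ xs)

  resolve : Trie → Trie → List Letter → Bool
  resolve t f xs = continue t f xs (verdict 0 xs xs xs)

  continue : Trie → Trie → List Letter → Verdict → Bool
  continue t f xs squareless  = refutes f xs
  continue t f xs square      = refutes t xs
  continue t f xs overlapping = true

  resolveFalse : Trie → List Letter → Bool
  -- Fourteen letters of probe limit the periods to 7. A longer square that is missed leaves a
  -- branch open and does no harm to soundness.
  resolveFalse f xs = continueFalse f xs (verdict 0 xs xs (take 14 xs))

  continueFalse : Trie → List Letter → Verdict → Bool
  continueFalse f xs squareless = refutes f xs
  continueFalse f xs _          = true

data Comparison (w : InfiniteWord Letter) (i j l : ℕ) : Verdict → Set where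
  differ   : ¬ Agree w i j l → Comparison w i j l squareless
  coincide : Agree w i j l → Comparison w i j l square
  extend   : ∀ {i′ j′} → i ≡ suc i′ → j ≡ suc j′ → w i′ ≡ w j′ → Agree w i j l →
             Comparison w i j l overlapping

comparison : ∀ w l i j →
  Comparison w i j l (compare l (applyDownFrom w (l + j)) (applyDownFrom w (l + i)))
comparison w zero i       zero    = coincide λ _ ()
comparison w zero zero    (suc j) = coincide λ _ ()
comparison w zero (suc i) (suc j) with w j == w i | ==-reflects (w j) (w i)
... | true  | ofʸ eq = extend refl refl (sym eq) λ _ ()
... | false | _      = coincide λ _ ()
comparison w (suc l) i j with w (l + j) == w (l + i) | ==-reflects (w (l + j)) (w (l + i))
... | false | ofⁿ neq = differ λ ag → neq (sym (ag l ≤-refl))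
... | true  | ofʸ eq with compare l (applyDownFrom w (l + j)) (applyDownFrom w (l + i))
                        | comparison w l i j
...   | _ | differ ¬ag        = differ λ ag → ¬ag (Agree-≤ {w = w} (n≤1+n l) ag)
...   | _ | coincide ag       = coincide (Agree-suc w ag (sym eq))
...   | _ | extend i≡ j≡ eq′ ag = extend i≡ j≡ eq′ (Agree-suc w ag (sym eq))

-- `none` asserts nothing, since a shortened probe may miss squares. That a full probe misses none
-- is proved separately in `verdict-squareless`.
data Evidence (w : InfiniteWord Letter) (n : ℕ) : Verdict → Set where
  none        : Evidence w n squareless
  square      : SquareSuffix w n → Evidence w n square
  overlapping : SquareSuffix w n → ¬ NoOverlap w → Evidence w n overlapping

worse-evidence : ∀ {w n u v} → Evidence w n u → Evidence w n v → Evidence w n (worse u v)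
worse-evidence none               ev                = ev
worse-evidence (square sq)        none              = square sq
worse-evidence (square sq)        (square _)        = square sq
worse-evidence (square sq)        (overlapping _ o) = overlapping sq o
worse-evidence (overlapping sq o) _                 = overlapping sq o

comparison⇒evidence : ∀ w p i {v} → Comparison w i (suc p + i) (suc p) v →
                      Evidence w (suc p + (suc p + i)) v
comparison⇒evidence w p i (differ _)    = none
comparison⇒evidence w p i (coincide ag) = square (p , i , refl , ag)
comparison⇒evidence w p (suc i) (extend {j′ = j′} refl refl eq ag) =
  -- The overlap starts at `i`, one letter before the square: `eq` gives its first pair of letters
  -- and `ag` the remaining ones.
  overlapping (p , suc i , refl , ag) λ free → free p i λ where
    zero    _         → trans eq (cong w (+-suc p i))
    (suc k) (s<s k<l) → trans (cong w (sym (+-suc k i)))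
      (trans (ag k k<l) (cong w (trans (cong (λ j → k + suc j) (+-suc p i))
                                      (+-suc k (suc (p + i))))))

-- The whole word has 2p + r letters, so `r` counts those left over by a square of period `p`. Two
-- letters of probe thus guarantee room for period `suc p`.
verdict-evidence : ∀ w p m r probe → m ≡ p + r → length probe ≤ r →
  Evidence w (p + m) (verdict p (applyDownFrom w (p + m)) (applyDownFrom w m) probe)
verdict-evidence w p zero    r (_ ∷ _ ∷ _) m≡ (s≤s (s≤s _)) with () ← trans m≡ (+-suc p _)
verdict-evidence w p zero    r []          _  _ = none
verdict-evidence w p zero    r (_ ∷ [])    _  _ = none
verdict-evidence w p (suc m) r []          _  _ = none
verdict-evidence w p (suc m) r (_ ∷ [])    _  _ = none
verdict-evidence w p (suc m) (suc (suc r)) (_ ∷ _ ∷ probe) m≡ (s≤s (s≤s len))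
  with refl ← suc-injective (trans m≡ (trans (+-suc p (suc r)) (cong suc (+-suc p r))))
  rewrite +-suc p (suc p + r) =
  worse-evidence (comparison⇒evidence w p r (comparison w (suc p) r (suc p + r)))
                 (verdict-evidence w (suc p) (suc p + r) r probe refl len)

worse-squareless : ∀ u v → worse u v ≡ squareless → u ≡ squareless × v ≡ squareless
worse-squareless squareless  v           eq = refl , eq
worse-squareless square      squareless  ()
worse-squareless square      square      ()
worse-squareless square      overlapping ()
worse-squareless overlapping _           ()

squareless⇒disagree : ∀ {w i j l v} → Comparison w i j l v → v ≡ squareless → ¬ Agree w i j l
squareless⇒disagree (differ ¬ag) refl = ¬ag

too-long : ∀ {p q r i} → p ≤ q → r < 2 → suc q + (suc q + i) ≢ p + (p + r)
too-long {p} {q} {r} {i} p≤q r<2 eq = <-irrefl (sym eq) (begin-strict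
  p + (p + r)         ≤⟨ +-mono-≤ p≤q (+-monoˡ-≤ r p≤q) ⟩
  q + (q + r)         <⟨ +-monoʳ-< q (+-monoʳ-< q r<2) ⟩
  q + (q + 2)         ≡⟨ cong (q +_) (trans (+-suc q 1) (cong suc (+-comm q 1))) ⟩
  q + suc (suc q)     ≡⟨ +-suc q (suc q) ⟩
  suc q + suc q       ≤⟨ +-monoʳ-≤ (suc q) (m≤m+n (suc q) i) ⟩
  suc q + (suc q + i) ∎)
  where open ≤-Reasoning

-- Here the probe has exactly `r` letters. The loop stops when fewer than two remain, and by
-- `too-long` no larger period then fits twice into the word.
verdict-squareless : ∀ w p m r → m ≡ p + r →
  verdict p (applyDownFrom w (p + m)) (applyDownFrom w m) (applyDownFrom w r) ≡ squareless →
  ∀ q i → p ≤ q → suc q + (suc q + i) ≡ p + m → ¬ Agree w i (suc q + i) (suc q)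
verdict-squareless w p m zero       refl _ q i p≤q end _ = too-long p≤q z<s end
verdict-squareless w p m (suc zero) refl _ q i p≤q end _ = too-long p≤q (s<s z<s) end
verdict-squareless w p zero (suc (suc r)) m≡ _ with () ← trans m≡ (+-suc p _)
verdict-squareless w p (suc m) (suc (suc r)) m≡ eq q i p≤q end ag
  with refl ← suc-injective (trans m≡ (trans (+-suc p (suc r)) (cong suc (+-suc p r))))
  rewrite +-suc p (suc p + r)
  with eq₁ , eq₂ ← worse-squareless
    (compare (suc p) (applyDownFrom w (suc p + (suc p + r))) (applyDownFrom w (suc p + r))) _ eq
  with m≤n⇒m<n∨m≡n p≤q
... | inj₁ p<q = verdict-squareless w (suc p) (suc p + r) r refl eq₂ q i p<q end ag
... | inj₂ refl with refl ← +-cancelˡ-≡ (suc p) _ _ (+-cancelˡ-≡ (suc p) _ _ end) =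
  squareless⇒disagree (comparison w (suc p) r (suc p + r)) eq₁ ag

-- As `refutes` is `false` at `stop`, the value `true` also shows that no branch survives to the
-- depth limit of 90. The booleans are the curling marks of the prefix, and both lists have the last
-- entry first.
refutes-ab : refutes (trie 90 (false ∷ false ∷ [])) (𝐛 ∷ 𝐚 ∷ []) ≡ true
refutes-ab = refl

refutes-aab : refutes (trie 90 (false ∷ true ∷ false ∷ [])) (𝐛 ∷ 𝐚 ∷ 𝐚 ∷ []) ≡ true
refutes-aab = refl

-- Soundness of the search

module _ (v : InfiniteWord Letter) (β : InfiniteWord Bool) (v-free : NoOverlap v)
         (β-free : NoOverlap β) (β-reflects : ∀ n → Reflects (SquareEndsAt v n) (β n)) where

  -- The marks β follow a single path through the tree; it cannot run into `dead`, because β is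
  -- overlap-free.
  Branch : Trie → ℕ → Set
  Branch dead       n = ⊥
  Branch stop       n = ⊤
  Branch (node t f) n = if β n then Branch t (suc n) else Branch f (suc n)

  overlapEnds-sound : ∀ n → overlapEnds (applyDownFrom β n) ≢ true
  overlapEnds-sound n eq with any-true _ periods eq
  ... | p , _ , found with drop-applyDownFrom β (suc p) n
  ...   | inj₂ empty = overrun (applyDownFrom β n) empty found
    where
    overrun : ∀ bs {ys} → ys ≡ [] → prefixesAgree Bool._≟_ (2 + p) bs ys ≢ true
    overrun []      refl ()
    overrun (_ ∷ _) refl ()
  ...   | inj₁ (m , n≡ , dropped)
    with prefixesAgree⇒agree Bool._≟_ β (suc p) (2 + p) m n n≡
           (trans (cong (prefixesAgree Bool._≟_ (2 + p) (applyDownFrom β n)) (sym dropped)) found)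
  ...     | i , _ , ag = β-free p i ag

  trie-branch : ∀ d n → Branch (trie d (applyDownFrom β n)) n
  trie-branch zero    n = tt
  trie-branch (suc d) n with overlapEnds (applyDownFrom β n) in eq
  ... | true  = overlapEnds-sound n eq
  ... | false with β n | trie-branch d (suc n)
  ...   | true  | br = br
  ...   | false | br = br

  verdict-sound : ∀ n probe → length probe ≤ suc n →
    let xs = applyDownFrom v (suc n) in Evidence v (suc n) (verdict 0 xs xs probe)
  verdict-sound n probe len = verdict-evidence v 0 (suc n) (suc n) probe refl len

  mutual
    refutes-sound : ∀ t n → Branch t n → refutes t (applyDownFrom v n) ≢ true
    refutes-sound dead                  n () eq
    refutes-sound stop                  n br ()
    refutes-sound (node dead dead)      n br eq with β n
    refutes-sound (node dead dead)      n () eq | true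
    refutes-sound (node dead dead)      n () eq | false
    refutes-sound (node dead stop)      n br eq =
      resolveFalse-sound stop n br
        (everyLetter-sound (λ x → resolveFalse stop (x ∷ applyDownFrom v n)) eq (v n))
    refutes-sound (node dead f@(node _ _)) n br eq =
      resolveFalse-sound f n br
        (everyLetter-sound (λ x → resolveFalse f (x ∷ applyDownFrom v n)) eq (v n))
    refutes-sound (node stop f)         n br eq =
      resolve-sound stop f n br
        (everyLetter-sound (λ x → resolve stop f (x ∷ applyDownFrom v n)) eq (v n))
    refutes-sound (node t@(node _ _) f) n br eq =
      resolve-sound t f n br
        (everyLetter-sound (λ x → resolve t f (x ∷ applyDownFrom v n)) eq (v n))

    resolve-sound : ∀ t f n → Branch (node t f) n → resolve t f (applyDownFrom v (suc n)) ≢ true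
    resolve-sound t f n br eq
      with verdict 0 xs xs xs in vd | verdict-sound n xs (≤-reflexive (length-applyDownFrom v (suc n)))
         | β n | β-reflects n
      where xs = applyDownFrom v (suc n)
    ... | squareless  | _               | false | _      = refutes-sound f (suc n) br eq
    ... | squareless  | _               | true  | ofʸ (q , i , end , ag) =
      verdict-squareless v 0 (suc n) (suc n) refl vd q i z≤n end ag
    ... | square      | _               | true  | _      = refutes-sound t (suc n) br eq
    ... | square      | square sq       | false | ofⁿ ¬sq = ¬sq sq
    ... | overlapping | overlapping _ o | _     | _      = o v-free

    resolveFalse-sound : ∀ f n → Branch (node dead f) n →
                         resolveFalse f (applyDownFrom v (suc n)) ≢ true
    resolveFalse-sound f n br eq with β n | β-reflects n
    ... | false | ofⁿ ¬sq with verdict 0 xs xs (take 14 xs) | verdict-sound n (take 14 xs) probe≤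
      where
      xs = applyDownFrom v (suc n)
      probe≤ : length (take 14 xs) ≤ suc n
      probe≤ = ≤-trans (≤-reflexive (length-take 14 xs))
        (≤-trans (m⊓n≤n 14 _) (≤-reflexive (length-applyDownFrom v (suc n))))
    ...   | squareless  | _                = refutes-sound f (suc n) br eq
    ...   | square      | square sq        = ¬sq sq
    ...   | overlapping | overlapping sq _ = ¬sq sq

  β-verdict : ∀ n → let xs = applyDownFrom v (suc n) in
              verdict 0 xs xs xs ≡ squareless → β n ≡ false
  β-verdict n vd with β n | β-reflects n
  ... | false | _ = refl
  ... | true  | ofʸ (q , i , end , ag) =
    contradiction ag (verdict-squareless v 0 (suc n) (suc n) refl vd q i z≤n end)

  β-square : ∀ n → SquareEndsAt v n → β n ≡ true
  β-square n sq with β n | β-reflects n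
  ... | true  | _       = refl
  ... | false | ofⁿ ¬sq = contradiction sq ¬sq

  not-from : ∀ n {bs xs} → applyDownFrom β n ≡ bs → applyDownFrom v n ≡ xs →
             refutes (trie 90 bs) xs ≢ true
  not-from n refl refl = refutes-sound (trie 90 (applyDownFrom β n)) n (trie-branch 90 n)

  not-from-ab : v 0 ≡ 𝐚 → v 1 ≢ 𝐛
  not-from-ab v₀ v₁ = not-from 2
    (cong₂ _∷_ (β-verdict 1 vd) (cong (_∷ []) (β-verdict 0 refl)))
    (cong₂ _∷_ v₁ (cong (_∷ []) v₀))
    refutes-ab
    where
    vd : verdict 0 (v 1 ∷ v 0 ∷ []) (v 1 ∷ v 0 ∷ []) (v 1 ∷ v 0 ∷ []) ≡ squareless
    vd rewrite v₀ | v₁ = refl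

  not-from-aab : v 0 ≡ 𝐚 → v 1 ≡ 𝐚 → v 2 ≢ 𝐛
  not-from-aab v₀ v₁ v₂ = not-from 3
    (cong₂ _∷_ (β-verdict 2 vd) (cong₂ _∷_ (β-square 1 sq) (cong (_∷ []) (β-verdict 0 refl))))
    (cong₂ _∷_ v₂ (cong₂ _∷_ v₁ (cong (_∷ []) v₀)))
    refutes-aab
    where
    vd : let xs = v 2 ∷ v 1 ∷ v 0 ∷ [] in verdict 0 xs xs xs ≡ squareless
    vd rewrite v₀ | v₁ | v₂ = refl
    sq : SquareEndsAt v 1
    sq = 0 , 0 , refl , λ { zero _ → trans v₀ (sym v₁) ; (suc _) (s<s ()) }

-- Reduction of alphabets below four to the search

module _ {A B : Set} (σ : A → B) (σ-injective : ∀ {x y} → σ x ≡ σ y → x ≡ y)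
         (w : InfiniteWord A) where

  recode-noOverlap : NoOverlap w → NoOverlap (σ ∘ w)
  recode-noOverlap free p i ag = free p i λ k k<l → σ-injective (ag k k<l)

  -- Carries the marks over to the renamed word directly, so that `C` is only ever taken of the
  -- original word.
  recode-reflects : ∀ {n β} → Reflects (SquareEndsAt w n) β → Reflects (SquareEndsAt (σ ∘ w) n) β
  recode-reflects (ofʸ (p , i , end , ag)) = ofʸ (p , i , end , λ k k<l → cong σ (ag k k<l))
  recode-reflects (ofⁿ ¬sq) = ofⁿ λ where
    (p , i , end , ag) → ¬sq (p , i , end , λ k k<l → σ-injective (ag k k<l))

module _ (x y : Fin 3) where

  encode : Fin 3 → Letter
  encode z = if does (z Fin.≟ x) then 𝐚 else if does (z Fin.≟ y) then 𝐛 else 𝐜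

  encode-x : encode x ≡ 𝐚
  encode-x with x Fin.≟ x
  ... | yes _  = refl
  ... | no x≢x = contradiction refl x≢x

  encode-y : x ≢ y → encode y ≡ 𝐛
  encode-y x≢y with y Fin.≟ x | y Fin.≟ y
  ... | yes y≡x | _      = contradiction (sym y≡x) x≢y
  ... | no _    | yes _  = refl
  ... | no _    | no y≢y = contradiction refl y≢y

encode-injective : ∀ x y → x ≢ y → ∀ z z′ → encode x y z ≡ encode x y z′ → z ≡ z′
encode-injective = from-yes (Fin.all? λ x → Fin.all? λ y → ¬? (x Fin.≟ y) →-dec
  Fin.all? λ z → Fin.all? λ z′ → (encode x y z ≟ᴸ encode x y z′) →-dec (z Fin.≟ z′))
  where
  _≟ᴸ_ : DecidableEquality Letter
  x ≟ᴸ y = (x == y) because ==-reflects x y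

module _ {A : Set} (_≟_ : DecidableEquality A) (ι : A → Fin 3)
         (ι-injective : ∀ {x y} → ι x ≡ ι y → x ≡ y)
         (w : InfiniteWord A) (w-overlapFree : OverlapFree w)
         (C-overlapFree : OverlapFree (C _≟_ w)) where

  private
    w-free : NoOverlap w
    w-free = overlapFree⇒noOverlap w w-overlapFree

    β : InfiniteWord Bool
    β n = proj₁ (C-reflects _≟_ w w-free n)

    β-reflects : ∀ n → Reflects (SquareEndsAt w n) (β n)
    β-reflects n = proj₁ (proj₂ (C-reflects _≟_ w w-free n))

    C≡ : ∀ n → C _≟_ w n ≡ (if β n then 2 else 1)
    C≡ n = proj₂ (proj₂ (C-reflects _≟_ w w-free n))

    β-free : NoOverlap β
    β-free p i ag = overlapFree⇒noOverlap (C _≟_ w) C-overlapFree p i λ k k<l →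
      trans (C≡ (k + i)) (trans (cong (if_then 2 else 1) (ag k k<l)) (sym (C≡ (k + (suc p + i)))))

    module Recoded (y : A) (distinct : ι (w 0) ≢ ι y) where

      σ : A → Letter
      σ = encode (ι (w 0)) (ι y) ∘ ι

      σ-injective : ∀ {z z′} → σ z ≡ σ z′ → z ≡ z′
      σ-injective eq = ι-injective (encode-injective (ι (w 0)) (ι y) distinct _ _ eq)

      σw-free : NoOverlap (σ ∘ w)
      σw-free = recode-noOverlap σ σ-injective w w-free

      σw-reflects : ∀ n → Reflects (SquareEndsAt (σ ∘ w) n) (β n)
      σw-reflects n = recode-reflects σ σ-injective w (β-reflects n)

  -- As xxx is an overlap, the second or the third letter differs from the first. Renaming the first
  -- letter to a and the first different one to b leaves the prefixes ab and aab.
  no-word-on-three-letters : ⊥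
  no-word-on-three-letters with ι (w 1) Fin.≟ ι (w 0) | ι (w 2) Fin.≟ ι (w 0)
  ... | no w₁≢w₀ | _ =
    not-from-ab (σ ∘ w) β σw-free β-free σw-reflects
      (encode-x x₀ x₁) (encode-y x₀ x₁ (w₁≢w₀ ∘ sym))
    where
    x₀ = ι (w 0)
    x₁ = ι (w 1)
    open Recoded (w 1) (w₁≢w₀ ∘ sym)
  ... | yes w₁≡w₀ | no w₂≢w₀ =
    not-from-aab (σ ∘ w) β σw-free β-free σw-reflects (encode-x x₀ x₂)
      (trans (cong (encode x₀ x₂) w₁≡w₀) (encode-x x₀ x₂)) (encode-y x₀ x₂ (w₂≢w₀ ∘ sym))
    where
    x₀ = ι (w 0)
    x₂ = ι (w 2)
    open Recoded (w 2) (w₂≢w₀ ∘ sym)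
  ... | yes w₁≡w₀ | yes w₂≡w₀ = w-free 0 0 λ where
    zero          _               → ι-injective (sym w₁≡w₀)
    (suc zero)    _               → ι-injective (trans w₁≡w₀ (sym w₂≡w₀))
    (suc (suc _)) (s<s (s<s ()))

no-word-below-four : ∀ k → k < 4 →
  ¬ (∃ λ (w : InfiniteWord (Fin k)) → OverlapFree w × OverlapFree (C Fin._≟_ w))
no-word-below-four k (s≤s k≤3) (w , w-overlapFree , C-overlapFree) =
  no-word-on-three-letters Fin._≟_ (λ x → inject≤ x k≤3) (Fin.inject≤-injective k≤3 k≤3 _ _)
    w w-overlapFree C-overlapFree

-- The Thue-Morse word

odd : ℕ → Bool
odd zero    = false
odd (suc n) = not (odd n)

-- The parity of the sum of the `d` lowest binary digits of `n`. Taking `d` to be `n` covers all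
-- digits, because halving a positive number decreases it.
bitParity : ℕ → ℕ → Bool
bitParity zero    n = false
bitParity (suc d) n = odd n xor bitParity d ⌊ n /2⌋

opaque

  thueMorse : InfiniteWord Bool
  thueMorse n = bitParity n n

bitParity-zero : ∀ d → bitParity d 0 ≡ false
bitParity-zero zero    = refl
bitParity-zero (suc d) = bitParity-zero d

odd-*2 : ∀ n → odd (n * 2) ≡ false
odd-*2 zero    = refl
odd-*2 (suc n) = trans (Bool.not-involutive _) (odd-*2 n)

⌊n*2/2⌋≡n : ∀ n → ⌊ n * 2 /2⌋ ≡ n
⌊n*2/2⌋≡n zero    = refl
⌊n*2/2⌋≡n (suc n) = cong suc (⌊n*2/2⌋≡n n)

⌊1+n*2/2⌋≡n : ∀ n → ⌊ suc (n * 2) /2⌋ ≡ n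
⌊1+n*2/2⌋≡n zero    = refl
⌊1+n*2/2⌋≡n (suc n) = cong suc (⌊1+n*2/2⌋≡n n)

n≤n*2 : ∀ n → n ≤ n * 2
n≤n*2 n = m≤m*n n 2

opaque
  unfolding thueMorse

  bitParity-stable : ∀ d n → n ≤ d → bitParity d n ≡ thueMorse n
  bitParity-stable d n = go d n n ≤-refl
    where
    go : ∀ d e n → n ≤ e → n ≤ d → bitParity d n ≡ bitParity e n
    go d       e       zero    _         _         = trans (bitParity-zero d) (sym (bitParity-zero e))
    go (suc d) (suc e) (suc n) (s≤s n≤e) (s≤s n≤d) = cong (odd (suc n) xor_)
      (go d e ⌊ suc n /2⌋ (≤-trans (half≤ n) n≤e) (≤-trans (half≤ n) n≤d))
      where
      half≤ : ∀ n → ⌊ suc n /2⌋ ≤ n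
      half≤ n = ≤-pred (⌊n/2⌋<n n)

  thueMorse-even : ∀ n → thueMorse (n * 2) ≡ thueMorse n
  thueMorse-even n = begin
    thueMorse (n * 2)
      ≡⟨ sym (bitParity-stable (suc (n * 2)) (n * 2) (n≤1+n _)) ⟩
    odd (n * 2) xor bitParity (n * 2) ⌊ n * 2 /2⌋
      ≡⟨ cong₂ _xor_ (odd-*2 n) (cong (bitParity (n * 2)) (⌊n*2/2⌋≡n n)) ⟩
    bitParity (n * 2) n
      ≡⟨ bitParity-stable (n * 2) n (n≤n*2 n) ⟩
    thueMorse n ∎
    where open ≡-Reasoning

  thueMorse-odd : ∀ n → thueMorse (suc (n * 2)) ≡ not (thueMorse n)
  thueMorse-odd n = cong₂ _xor_ (cong not (odd-*2 n))
    (trans (cong (bitParity (n * 2)) (⌊1+n*2/2⌋≡n n)) (bitParity-stable (n * 2) n (n≤n*2 n)))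

half : ∀ n → (∃ λ h → n ≡ h * 2) ⊎ (∃ λ h → n ≡ suc (h * 2))
half zero    = inj₁ (0 , refl)
half (suc n) with half n
... | inj₁ (h , refl) = inj₂ (h , refl)
... | inj₂ (h , refl) = inj₁ (suc h , refl)

-- The word is a concatenation of the pairs 01 and 10, and these start at the even positions.
thueMorse-flip : ∀ n → odd n ≡ false → thueMorse (suc n) ≡ not (thueMorse n)
thueMorse-flip n even with half n
... | inj₁ (h , refl) = trans (thueMorse-odd h) (cong not (sym (thueMorse-even h)))
... | inj₂ (h , refl) with () ← trans (sym (cong not (odd-*2 h))) even

odd-+ : ∀ m n → odd (m + n) ≡ odd m xor odd n
odd-+ zero    n = refl
odd-+ (suc m) n = trans (cong not (odd-+ m n)) (Bool.not-distribˡ-xor (odd m) (odd n))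

-- An odd period p carries the flips at even positions over to odd ones, so that the word
-- alternates along a whole period and cannot return to the same letter after p steps.
odd-period : ∀ p i → odd p ≡ true → ¬ Agree thueMorse i (p + i) (suc p)
odd-period p i p-odd agree = Bool.not-¬ (sym (agree 0 z<s)) (begin
  thueMorse (p + i)       ≡⟨ alternates p ≤-refl ⟩
  odd p xor thueMorse i   ≡⟨ cong (_xor thueMorse i) p-odd ⟩
  not (thueMorse i)       ∎)
  where
  open ≡-Reasoning
  flips : ∀ k → k < p → thueMorse (suc k + i) ≡ not (thueMorse (k + i))
  flips k k<p = by-parity (odd (k + i)) refl
    where
    even : odd (k + i) ≡ true → odd (k + (p + i)) ≡ false
    even k+i-odd = begin
      odd (k + (p + i))     ≡⟨ cong odd (trans (sym (+-assoc k p i))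
                                 (trans (cong (_+ i) (+-comm k p)) (+-assoc p k i))) ⟩
      odd (p + (k + i))     ≡⟨ odd-+ p (k + i) ⟩
      odd p xor odd (k + i) ≡⟨ cong₂ _xor_ p-odd k+i-odd ⟩
      false                 ∎
    by-parity : ∀ o → odd (k + i) ≡ o → thueMorse (suc k + i) ≡ not (thueMorse (k + i))
    by-parity false k+i-even = thueMorse-flip (k + i) k+i-even
    by-parity true  k+i-odd  = begin
      thueMorse (suc k + i)         ≡⟨ agree (suc k) (s<s k<p) ⟩
      thueMorse (suc k + (p + i))   ≡⟨ thueMorse-flip (k + (p + i)) (even k+i-odd) ⟩
      not (thueMorse (k + (p + i))) ≡⟨ cong not (sym (agree k (m<n⇒m<1+n k<p))) ⟩
      not (thueMorse (k + i))       ∎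
  alternates : ∀ k → k ≤ p → thueMorse (k + i) ≡ odd k xor thueMorse i
  alternates zero    _   = refl
  alternates (suc k) k<p = trans (flips k k<p)
    (trans (cong not (alternates k (<⇒≤ k<p))) (Bool.not-distribˡ-xor (odd k) _))

-- Infinite descent on the period. For an even period 2h, every second letter of the overlap, from
-- the first to the last, is a letter of t at half the position, complemented if the start is odd.
-- The 1 + h equalities obtained form an overlap of period h.
thueMorse-noOverlap : NoOverlap thueMorse
thueMorse-noOverlap p i = go (suc p) (<-wellFounded (suc p)) i z<s
  where
  go : ∀ p → Acc _<_ p → ∀ i → 0 < p → ¬ Agree thueMorse i (p + i) (suc p)
  go p (acc rec) i 0<p agree with half p | half i
  ... | inj₂ (h , refl) | _ = odd-period p i (cong not (odd-*2 h)) agree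
  ... | inj₁ (zero , refl) | _ with () ← 0<p
  ... | inj₁ (h@(suc _) , refl) | inj₁ (j , refl) =
    go h (rec (m<m*n h 2 ≤-refl)) j z<s λ k k≤h → begin
      thueMorse (k + j)               ≡⟨ sym (thueMorse-even (k + j)) ⟩
      thueMorse ((k + j) * 2)         ≡⟨ cong thueMorse (*-distribʳ-+ 2 k j) ⟩
      thueMorse (k * 2 + j * 2)       ≡⟨ agree (k * 2) (s≤s (*-monoˡ-≤ 2 (≤-pred k≤h))) ⟩
      thueMorse (k * 2 + (h * 2 + j * 2)) ≡⟨ cong (λ x → thueMorse (k * 2 + x)) (sym (*-distribʳ-+ 2 h j)) ⟩
      thueMorse (k * 2 + (h + j) * 2) ≡⟨ cong thueMorse (sym (*-distribʳ-+ 2 k (h + j))) ⟩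
      thueMorse ((k + (h + j)) * 2)   ≡⟨ thueMorse-even (k + (h + j)) ⟩
      thueMorse (k + (h + j))         ∎
    where open ≡-Reasoning
  ... | inj₁ (h@(suc _) , refl) | inj₂ (j , refl) =
    go h (rec (m<m*n h 2 ≤-refl)) j z<s λ k k≤h → Bool.not-injective (begin
      not (thueMorse (k + j))               ≡⟨ sym (thueMorse-odd (k + j)) ⟩
      thueMorse (suc ((k + j) * 2))         ≡⟨ cong (thueMorse ∘ suc) (*-distribʳ-+ 2 k j) ⟩
      thueMorse (suc (k * 2 + j * 2))       ≡⟨ cong thueMorse (sym (+-suc (k * 2) (j * 2))) ⟩
      thueMorse (k * 2 + suc (j * 2))       ≡⟨ agree (k * 2) (s≤s (*-monoˡ-≤ 2 (≤-pred k≤h))) ⟩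
      thueMorse (k * 2 + (h * 2 + suc (j * 2)))
        ≡⟨ cong (λ x → thueMorse (k * 2 + x))
             (trans (+-suc (h * 2) (j * 2)) (cong suc (sym (*-distribʳ-+ 2 h j)))) ⟩
      thueMorse (k * 2 + suc ((h + j) * 2)) ≡⟨ cong thueMorse (+-suc (k * 2) _) ⟩
      thueMorse (suc (k * 2 + (h + j) * 2)) ≡⟨ cong (thueMorse ∘ suc) (sym (*-distribʳ-+ 2 k (h + j))) ⟩
      thueMorse (suc ((k + (h + j)) * 2))   ≡⟨ thueMorse-odd (k + (h + j)) ⟩
      not (thueMorse (k + (h + j)))         ∎)
    where open ≡-Reasoning

-- The word on four letters

-- Found by computer search. The first and the last block belong to triples that do not occur in
-- the Thue-Morse word; they only have to differ from the others.
block : Bool → Bool → Bool → Vec (Fin 4) 16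
block false false false = 0F ∷ 0F ∷ 0F ∷ 0F ∷ 0F ∷ 0F ∷ 0F ∷ 0F ∷ 0F ∷ 0F ∷ 0F ∷ 0F ∷ 0F ∷ 0F ∷ 0F ∷ 0F ∷ []
block false false true  = 2F ∷ 2F ∷ 3F ∷ 0F ∷ 0F ∷ 1F ∷ 0F ∷ 0F ∷ 1F ∷ 2F ∷ 0F ∷ 0F ∷ 1F ∷ 2F ∷ 2F ∷ 0F ∷ []
block false true  false = 0F ∷ 3F ∷ 2F ∷ 2F ∷ 0F ∷ 0F ∷ 3F ∷ 1F ∷ 3F ∷ 1F ∷ 1F ∷ 3F ∷ 1F ∷ 2F ∷ 1F ∷ 1F ∷ []
block false true  true  = 0F ∷ 3F ∷ 2F ∷ 2F ∷ 0F ∷ 0F ∷ 3F ∷ 1F ∷ 3F ∷ 1F ∷ 1F ∷ 2F ∷ 2F ∷ 0F ∷ 2F ∷ 2F ∷ []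
block true  false false = 2F ∷ 1F ∷ 2F ∷ 0F ∷ 0F ∷ 1F ∷ 0F ∷ 0F ∷ 1F ∷ 2F ∷ 0F ∷ 0F ∷ 1F ∷ 2F ∷ 2F ∷ 3F ∷ []
block true  false true  = 2F ∷ 1F ∷ 2F ∷ 0F ∷ 0F ∷ 1F ∷ 0F ∷ 0F ∷ 1F ∷ 2F ∷ 0F ∷ 0F ∷ 1F ∷ 2F ∷ 2F ∷ 0F ∷ []
block true  true  false = 0F ∷ 3F ∷ 0F ∷ 0F ∷ 3F ∷ 0F ∷ 3F ∷ 1F ∷ 3F ∷ 1F ∷ 1F ∷ 3F ∷ 1F ∷ 2F ∷ 1F ∷ 1F ∷ []
block true  true  true  = 1F ∷ 1F ∷ 1F ∷ 1F ∷ 1F ∷ 1F ∷ 1F ∷ 1F ∷ 1F ∷ 1F ∷ 1F ∷ 1F ∷ 1F ∷ 1F ∷ 1F ∷ 1F ∷ []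

letterAt : ℕ → Fin 16 → Fin 4
letterAt j o = lookup (block (thueMorse j) (thueMorse (1 + j)) (thueMorse (2 + j))) o

opaque

  blockWord : InfiniteWord (Fin 4)
  blockWord m = letterAt (m / 16) (m mod 16)

  blockWord-letterAt : ∀ j o → blockWord (toℕ o + j * 16) ≡ letterAt j o
  blockWord-letterAt j o = cong₂ letterAt quotient remainder
    where
    open ≡-Reasoning
    quotient : (toℕ o + j * 16) / 16 ≡ j
    quotient = begin
      (toℕ o + j * 16) / 16      ≡⟨ +-distrib-/-∣ʳ (toℕ o) (n∣m*n j) ⟩
      toℕ o / 16 + j * 16 / 16   ≡⟨ cong₂ _+_ (m<n⇒m/n≡0 (Fin.toℕ<n o)) (m*n/n≡m j 16) ⟩
      j                          ∎
    remainder : (toℕ o + j * 16) mod 16 ≡ o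
    remainder = Fin.toℕ-injective (begin
      toℕ ((toℕ o + j * 16) mod 16) ≡⟨ Fin.toℕ-fromℕ< _ ⟩
      (toℕ o + j * 16) % 16         ≡⟨ [m+kn]%n≡m%n (toℕ o) j 16 ⟩
      toℕ o % 16                    ≡⟨ m<n⇒m%n≡m (Fin.toℕ<n o) ⟩
      toℕ o                         ∎)

window : {A : Set ℓ} → InfiniteWord A → ℕ → ℕ → List A
window w i l = applyUpTo (λ k → w (k + i)) l

-- The Thue-Morse morphism, under which `thueMorse` is fixed.
μ : List Bool → List Bool
μ []       = []
μ (x ∷ xs) = x ∷ not x ∷ μ xs

blocks : List Bool → List (Fin 4)
blocks (x ∷ y ∷ z ∷ bs) = toList (block x y z) ++ blocks (y ∷ z ∷ bs)
blocks _                = []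

-- Stated for arbitrary functions related like t and its image, so that the induction can pass to
-- shifted functions.
μ-applyUpTo : ∀ f g l → (∀ k → g (k * 2) ≡ f k) → (∀ k → g (suc (k * 2)) ≡ not (f k)) →
              μ (applyUpTo f l) ≡ applyUpTo g (l * 2)
μ-applyUpTo f g zero    even odd′ = refl
μ-applyUpTo f g (suc l) even odd′ = cong₂ _∷_ (sym (even 0)) (cong₂ _∷_ (sym (odd′ 0))
  (μ-applyUpTo (f ∘ suc) (g ∘ suc ∘ suc) l (even ∘ suc) (odd′ ∘ suc)))

μ-window : ∀ i l → μ (window thueMorse i l) ≡ window thueMorse (i * 2) (l * 2)
μ-window i l = μ-applyUpTo (λ k → thueMorse (k + i)) (λ k → thueMorse (k + i * 2)) l
  (λ k → trans (cong thueMorse (sym (*-distribʳ-+ 2 k i))) (thueMorse-even (k + i)))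
  (λ k → trans (cong (thueMorse ∘ suc) (sym (*-distribʳ-+ 2 k i))) (thueMorse-odd (k + i)))

μ^ : ℕ → List Bool → List Bool
μ^ zero    xs = xs
μ^ (suc n) xs = μ^ n (μ xs)

μ^-window : ∀ n i l → μ^ n (window thueMorse i l) ≡ window thueMorse (i * 2 ^ n) (l * 2 ^ n)
μ^-window zero    i l = sym (cong₂ (window thueMorse) (*-identityʳ i) (*-identityʳ l))
μ^-window (suc n) i l = begin
  μ^ n (μ (window thueMorse i l))                ≡⟨ cong (μ^ n) (μ-window i l) ⟩
  μ^ n (window thueMorse (i * 2) (l * 2))        ≡⟨ μ^-window n (i * 2) (l * 2) ⟩
  window thueMorse (i * 2 * 2 ^ n) (l * 2 * 2 ^ n)
    ≡⟨ cong₂ (window thueMorse) (*-assoc i 2 (2 ^ n)) (*-assoc l 2 (2 ^ n)) ⟩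
  window thueMorse (i * 2 ^ suc n) (l * 2 ^ suc n) ∎
  where open ≡-Reasoning

toList-lookup : ∀ {A : Set ℓ} {n} (v : Vec A n) g → (∀ o → g (toℕ o) ≡ lookup v o) →
                toList v ≡ applyUpTo g n
toList-lookup []      g eq = refl
toList-lookup (x ∷ v) g eq = cong₂ _∷_ (sym (eq 0F)) (toList-lookup v (g ∘ suc) (eq ∘ Fin.suc))

blocks-applyUpTo : ∀ f g l →
  (∀ k o → g (toℕ o + k * 16) ≡ lookup (block (f k) (f (1 + k)) (f (2 + k))) o) →
  blocks (applyUpTo f (2 + l)) ≡ applyUpTo g (l * 16)
blocks-applyUpTo f g zero    eq = refl
blocks-applyUpTo f g (suc l) eq = begin
  toList (block (f 0) (f 1) (f 2)) ++ blocks (applyUpTo (f ∘ suc) (2 + l))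
    ≡⟨ cong₂ _++_ (toList-lookup _ g λ o → trans (cong g (sym (+-identityʳ (toℕ o)))) (eq 0 o))
                  (blocks-applyUpTo (f ∘ suc) (g ∘ (16 +_)) l λ k o →
                    trans (cong g (shift k o)) (eq (suc k) o)) ⟩
  applyUpTo g 16 ++ applyUpTo (g ∘ (16 +_)) (l * 16)
    ≡⟨ sym (applyUpTo-++ g 16 (l * 16)) ⟩
  applyUpTo g (suc l * 16) ∎
  where
  open ≡-Reasoning
  shift : ∀ k (o : Fin 16) → 16 + (toℕ o + k * 16) ≡ toℕ o + suc k * 16
  shift k o = trans (sym (+-assoc 16 (toℕ o) (k * 16)))
    (trans (cong (_+ k * 16) (+-comm 16 (toℕ o))) (+-assoc (toℕ o) 16 (k * 16)))

blocks-window : ∀ i l → blocks (window thueMorse i (2 + l)) ≡ window blockWord (i * 16) (l * 16)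
blocks-window i l = blocks-applyUpTo
  (λ k → thueMorse (k + i)) (λ k → blockWord (k + i * 16)) l λ k o → trans
  (cong blockWord (trans (+-assoc (toℕ o) (k * 16) (i * 16))
                         (cong (toℕ o +_) (sym (*-distribʳ-+ 16 k i)))))
  (blockWord-letterAt (k + i) o)

-- Three letters t[q..q+2] determine the block word from 64 q on, far enough to check all properties
-- of bounded range at the positions 64 q + s with s < 64.
segment : List Bool → List (Fin 4)
segment xs = blocks (μ^ 2 xs)

segment≡window : ∀ q → segment (window thueMorse q 3) ≡ window blockWord (q * 64) 160
segment≡window q = begin
  blocks (μ^ 2 (window thueMorse q 3))     ≡⟨ cong blocks (μ^-window 2 q 3) ⟩
  blocks (window thueMorse (q * 4) 12)     ≡⟨ blocks-window (q * 4) 10 ⟩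
  window blockWord (q * 4 * 16) 160        ≡⟨ cong (λ i → window blockWord i 160) (*-assoc q 4 16) ⟩
  window blockWord (q * 64) 160            ∎
  where open ≡-Reasoning

-- Finite checks on the images of three letters

everyBool : (Bool → Bool) → Bool
everyBool f = f false ∧ f true

everyBool-sound : ∀ f → everyBool f ≡ true → ∀ x → f x ≡ true
everyBool-sound f eq false = Bool.∧-conicalˡ (f false) (f true) eq
everyBool-sound f eq true  = Bool.∧-conicalʳ (f false) (f true) eq

all-applyUpTo : ∀ {A : Set ℓ} (f : A → Bool) g n → all f (applyUpTo g n) ≡ true →
                ∀ k → k < n → f (g k) ≡ true
all-applyUpTo f g (suc n) eq zero    _         = Bool.∧-conicalˡ (f (g 0)) _ eq
all-applyUpTo f g (suc n) eq (suc k) (s<s k<n) =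
  all-applyUpTo f (g ∘ suc) n (Bool.∧-conicalʳ (f (g 0)) _ eq) k k<n

sameLetters : ℕ → List (Fin 4) → List (Fin 4) → Bool
sameLetters = prefixesAgree Fin._≟_

noSquare noOverlap : List (Fin 4) → ℕ → Bool
noSquare  xs p = not (sameLetters (suc p) xs (drop (suc p) xs))
noOverlap xs p = not (sameLetters (2 + p) xs (drop (suc p) xs))

-- Squares of periods 1 to 5 occur, as they realize C(w), and must only not extend to overlaps.
-- Periods 6 to 30 are excluded outright; from 31 on, a half of the square contains a whole block.
noMediumSquare noShortOverlap : List (Fin 4) → Bool
noMediumSquare xs = all (noSquare xs) (applyUpTo (5 +_) 25)
noShortOverlap xs = all (noOverlap xs) (applyUpTo (λ p → p) 5)

-- The squares of period suc p that occupy the last letters of a window of length 10 start at d.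
shortSquares : List (ℕ × ℕ)
shortSquares = (0 , 8) ∷ (1 , 6) ∷ (2 , 4) ∷ (3 , 2) ∷ (4 , 0) ∷ []

squareAt : List (Fin 4) → ℕ × ℕ → Bool
squareAt xs (p , d) = sameLetters (suc p) (drop d xs) (drop (suc p + d) xs)

shortSquareEnds : List (Fin 4) → Bool
shortSquareEnds xs = any (squareAt xs) shortSquares

-- Failing on an empty list of bits makes the check certify that the known part of t reaches far
-- enough.
coloured : List (Fin 4) → List Bool → Bool
coloured xs (x ∷ _) = does (shortSquareEnds xs Bool.≟ x)
coloured xs []      = false

noBlockStart : List (Fin 4) → Bool → Bool → Bool → Bool
noBlockStart xs x y z = not (sameLetters 16 (toList (block x y z)) xs)

noBlockStarts : List (Fin 4) → Bool
noBlockStarts xs = everyBool λ x → everyBool λ y → everyBool λ z → noBlockStart xs x y z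

synchronized : ℕ → List (Fin 4) → Bool
synchronized s xs = (s % 16 ≡ᵇ 0) ∨ noBlockStarts xs

Check : Set
Check = ℕ → List (Fin 4) → List Bool → Bool

-- Six applications of `μ` turn one letter into 64, so both lists start at position 64 q + s, the
-- one in the block word, the other in t.
checkAt : Check → List Bool → ℕ → Bool
checkAt check bs s = check s (drop s (segment bs)) (drop s (μ^ 6 bs))

checkTriple : Check → Bool → Bool → Bool → Bool
checkTriple check x y z = all (checkAt check (x ∷ y ∷ z ∷ [])) (applyUpTo (λ s → s) 64)

-- All eight triples can pass, even 000 and 111, which t omits: an image under `μ` has no three
-- equal letters in a row, so `segment` is built from the genuine blocks.
checkAll : Check → Bool
checkAll check = everyBool λ x → everyBool λ y → everyBool λ z → checkTriple check x y z

everyBool? : ∀ {P : Bool → Set ℓ} → (∀ x → Dec (P x)) → Dec (∀ x → P x)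
everyBool? {P = P} P? = map′ (λ (p , q) → λ { false → p ; true → q }) (λ p → p false , p true)
                             (P? false ×-dec P? true)

block-injective : ∀ x y z x′ y′ z′ → toList (block x y z) ≡ toList (block x′ y′ z′) →
                  x ≡ x′ × y ≡ y′ × z ≡ z′
block-injective = from-yes (everyBool? λ x → everyBool? λ y → everyBool? λ z →
  everyBool? λ x′ → everyBool? λ y′ → everyBool? λ z′ →
  List.≡-dec Fin._≟_ (toList (block x y z)) (toList (block x′ y′ z′)) →-dec
  (x Bool.≟ x′ ×-dec (y Bool.≟ y′ ×-dec z Bool.≟ z′)))

module _ {A : Set ℓ} where

  drop-applyUpTo : ∀ (f : ℕ → A) i l → drop i (applyUpTo f l) ≡ applyUpTo (f ∘ (i +_)) (l ∸ i)
  drop-applyUpTo f zero    l       = refl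
  drop-applyUpTo f (suc i) zero    = refl
  drop-applyUpTo f (suc i) (suc l) = drop-applyUpTo (f ∘ suc) i l

  drop-window : ∀ (w : InfiniteWord A) i j l → drop j (window w i l) ≡ window w (j + i) (l ∸ j)
  drop-window w i j l = trans (drop-applyUpTo (λ k → w (k + i)) j l)
    (applyUpTo-cong (l ∸ j) λ k _ →
      cong w (trans (cong (_+ i) (+-comm j k)) (+-assoc k j i)))

  module _ (_≟_ : DecidableEquality A) where

    agree⇒prefixesAgree : ∀ {f g : ℕ → A} l m n → (∀ k → k < l → f k ≡ g k) → l ≤ m → l ≤ n →
                          prefixesAgree _≟_ l (applyUpTo f m) (applyUpTo g n) ≡ true
    agree⇒prefixesAgree zero m n eq _ _ = refl
    agree⇒prefixesAgree {f} {g} (suc l) (suc m) (suc n) eq (s≤s l≤m) (s≤s l≤n) with f 0 ≟ g 0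
    ... | yes _  = agree⇒prefixesAgree l m n (λ k k<l → eq (suc k) (s<s k<l)) l≤m l≤n
    ... | no neq = contradiction (eq 0 z<s) neq

    applyUpTo-prefixesAgree : ∀ {f g : ℕ → A} l m n →
      prefixesAgree _≟_ l (applyUpTo f m) (applyUpTo g n) ≡ true → ∀ k → k < l → f k ≡ g k
    applyUpTo-prefixesAgree {f} {g} (suc l) (suc m) (suc n) eq k k<l with f 0 ≟ g 0
    applyUpTo-prefixesAgree (suc l) (suc m) (suc n) eq zero    _         | yes p = p
    applyUpTo-prefixesAgree (suc l) (suc m) (suc n) eq (suc k) (s<s k<l) | yes _ =
      applyUpTo-prefixesAgree l m n eq k k<l
    applyUpTo-prefixesAgree (suc l) zero    n       ()
    applyUpTo-prefixesAgree (suc l) (suc m) zero    ()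

    agree⇒window : ∀ (w : InfiniteWord A) i j m l n → Agree w (i + m) (j + m) l →
      l ≤ n ∸ i → l ≤ n ∸ j →
      prefixesAgree _≟_ l (drop i (window w m n)) (drop j (window w m n)) ≡ true
    agree⇒window w i j m l n agree l≤ l≤′ =
      trans (cong₂ (prefixesAgree _≟_ l) (drop-window w m i n) (drop-window w m j n))
            (agree⇒prefixesAgree l (n ∸ i) (n ∸ j) agree l≤ l≤′)

    window⇒agree : ∀ (w : InfiniteWord A) i j m l n →
      prefixesAgree _≟_ l (drop i (window w m n)) (drop j (window w m n)) ≡ true →
      Agree w (i + m) (j + m) l
    window⇒agree w i j m l n eq = applyUpTo-prefixesAgree l (n ∸ i) (n ∸ j)
      (trans (sym (cong₂ (prefixesAgree _≟_ l) (drop-window w m i n) (drop-window w m j n))) eq)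

block≡window : ∀ j → toList (block (thueMorse j) (thueMorse (1 + j)) (thueMorse (2 + j))) ≡
                     window blockWord (j * 16) 16
block≡window j = toList-lookup (block (thueMorse j) (thueMorse (1 + j)) (thueMorse (2 + j)))
  (λ k → blockWord (k + j * 16)) (blockWord-letterAt j)

not-true : ∀ {x} → not x ≡ true → x ≢ true
not-true {false} _ ()

any-∈ : ∀ {A : Set ℓ} (f : A → Bool) {x xs} → x ∈ xs → f x ≡ true → any f xs ≡ true
any-∈ f {xs = x ∷ _} (here refl) eq rewrite eq = refl
any-∈ f {xs = x ∷ _} (there x∈xs) eq rewrite any-∈ f x∈xs eq = Bool.∨-zeroʳ (f x)

shortSquares-end : ∀ {p d} → (p , d) ∈ shortSquares → suc p + (suc p + d) ≡ 10
shortSquares-end (here refl)                                 = refl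
shortSquares-end (there (here refl))                         = refl
shortSquares-end (there (there (here refl)))                 = refl
shortSquares-end (there (there (there (here refl))))         = refl
shortSquares-end (there (there (there (there (here refl))))) = refl

shortSquare : ∀ p → p < 5 → ∃ λ d → (p , d) ∈ shortSquares
shortSquare 0 _ = 8 , here refl
shortSquare 1 _ = 6 , there (here refl)
shortSquare 2 _ = 4 , there (there (here refl))
shortSquare 3 _ = 2 , there (there (there (here refl)))
shortSquare 4 _ = 0 , there (there (there (there (here refl))))
shortSquare (suc (suc (suc (suc (suc p))))) (s≤s (s≤s (s≤s (s≤s (s≤s ())))))

-- The offset is at most 63, so at least 160 - 63 = 97 letters are known from `m` on. This covers
-- two halves of 30 letters, the largest range that a check inspects.
record Window (m : ℕ) : Set where
  field
    offset quotient len colours : ℕ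
    m≡    : m ≡ offset + quotient * 64
    97≤   : 97 ≤ len
    holds : ∀ check → checkAll check ≡ true →
            check offset (window blockWord m len) (window thueMorse m colours) ≡ true

windowAt : ∀ m → Window m
windowAt m = record
  { offset   = s
  ; quotient = q
  ; len      = 160 ∸ s
  ; colours  = 192 ∸ s
  ; m≡       = m≡
  ; 97≤      = ∸-monoʳ-≤ 160 (≤-pred (m%n<n m 64))
  ; holds    = holds
  }
  where
  s = m % 64
  q = m / 64
  x = thueMorse q
  y = thueMorse (1 + q)
  z = thueMorse (2 + q)
  m≡ : m ≡ s + q * 64
  m≡ = m≡m%n+[m/n]*n m 64
  letters : drop s (segment (window thueMorse q 3)) ≡ window blockWord m (160 ∸ s)
  letters = trans (cong (drop s) (segment≡window q))
    (trans (drop-window blockWord (q * 64) s 160) (cong (λ i → window blockWord i (160 ∸ s)) (sym m≡)))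
  bits : drop s (μ^ 6 (window thueMorse q 3)) ≡ window thueMorse m (192 ∸ s)
  bits = trans (cong (drop s) (μ^-window 6 q 3))
    (trans (drop-window thueMorse (q * 64) s 192) (cong (λ i → window thueMorse i (192 ∸ s)) (sym m≡)))
  holds : ∀ check → checkAll check ≡ true →
          check s (window blockWord m (160 ∸ s)) (window thueMorse m (192 ∸ s)) ≡ true
  holds check true-everywhere = subst₂ (λ ys cs → check s ys cs ≡ true) letters bits
    (all-applyUpTo (checkAt check (window thueMorse q 3)) (λ s → s) 64
      (everyBool-sound (checkTriple check x y)
        (everyBool-sound (λ y → everyBool (checkTriple check x y))
          (everyBool-sound (λ x → everyBool λ y → everyBool (checkTriple check x y))
            true-everywhere x) y) z)
      s (m%n<n m 64))

window-head : ∀ {A : Set ℓ} (w : InfiniteWord A) i l {x xs} → x ∷ xs ≡ window w i l → x ≡ w i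
window-head w i (suc l) eq = List.∷-injectiveˡ eq

coloured-sound : ∀ xs i l bs → bs ≡ window thueMorse i l → coloured xs bs ≡ true →
                 shortSquareEnds xs ≡ thueMorse i
coloured-sound xs i l (b ∷ bs) eq ok with shortSquareEnds xs Bool.≟ b
... | yes found = trans found (window-head thueMorse i l eq)

synchronized-sound : ∀ s xs → synchronized s xs ≡ true → s % 16 ≡ 0 ⊎ noBlockStarts xs ≡ true
synchronized-sound s xs ok with s % 16
... | zero  = inj₁ refl
... | suc _ = inj₂ ok

noBlockStarts-sound : ∀ xs → noBlockStarts xs ≡ true → ∀ x y z → noBlockStart xs x y z ≡ true
noBlockStarts-sound xs ok x y z =
  everyBool-sound (noBlockStart xs x y)
    (everyBool-sound (λ y → everyBool (noBlockStart xs x y))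
      (everyBool-sound (λ x → everyBool λ y → everyBool (noBlockStart xs x y)) ok x) y) z

checkMedium checkShort checkColours checkSynchrony : Check
checkMedium    s xs bs = noMediumSquare xs
checkShort     s xs bs = noShortOverlap xs
-- The window of length 10 ends 9 letters after its start, and the j-th block realizes the j+1-st
-- block of 16 letters of the Thue-Morse word: 25 = 9 + 16.
checkColours   s xs bs = coloured xs (drop 25 bs)
checkSynchrony s xs bs = synchronized s xs

-- Local structure of the block word at an arbitrary position

module Windows {m : ℕ} (W : Window m) where

  open Window W

  private
    xs = window blockWord m len
    bs = window thueMorse m colours

  fits : ∀ i l → i + l ≤ 97 → l ≤ len ∸ i
  fits i l i+l≤ = ≤-trans (≤-reflexive (sym (m+n∸m≡n i l))) (∸-monoˡ-≤ i (≤-trans i+l≤ 97≤))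

  not-agree : ∀ i j l → i + l ≤ 97 → j + l ≤ 97 →
             not (sameLetters l (drop i xs) (drop j xs)) ≡ true →
             ¬ Agree blockWord (i + m) (j + m) l
  not-agree i j l i+l≤ j+l≤ eq agree = not-true eq
    (agree⇒window Fin._≟_ blockWord i j m l len agree (fits i l i+l≤) (fits j l j+l≤))

  no-medium-square : ∀ p → 5 ≤ p → p < 30 → ¬ Agree blockWord m (suc p + m) (suc p)
  no-medium-square p 5≤p p<30 with r , refl ← m≤n⇒∃[o]m+o≡n 5≤p =
    not-agree 0 (6 + r) (6 + r) (≤-trans (m≤m+n _ _) 2p≤) 2p≤
      (all-applyUpTo (noSquare xs) (5 +_) 25 (holds checkMedium refl) r (+-cancelˡ-< 5 r 25 p<30))
    where
    2p≤ : (6 + r) + (6 + r) ≤ 97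
    2p≤ = ≤-trans (+-mono-≤ p<30 p<30) (m≤m+n 60 37)

  no-short-overlap : ∀ p → p < 5 → ¬ Agree blockWord m (suc p + m) (2 + p)
  no-short-overlap p p<5 =
    not-agree 0 (suc p) (2 + p) (≤-trans (m≤n+m _ (suc p)) bound) bound
      (all-applyUpTo (noOverlap xs) (λ p → p) 5 (holds checkShort refl) p p<5)
    where
    bound : suc p + (2 + p) ≤ 97
    bound = ≤-trans (+-mono-≤ p<5 (s≤s p<5)) (m≤m+n 11 86)

  squareEnds≡thueMorse : shortSquareEnds xs ≡ thueMorse (25 + m)
  squareEnds≡thueMorse = coloured-sound xs (25 + m) (colours ∸ 25) (drop 25 bs)
    (drop-window thueMorse m 25 colours) (holds checkColours refl)

  thueMorse⇒square : thueMorse (25 + m) ≡ true → ∃₂ λ p d →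
    suc p + (suc p + d) ≡ 10 × Agree blockWord (d + m) (suc p + (d + m)) (suc p)
  thueMorse⇒square eq =
    let (p , d) , p∈ , found = any-true (squareAt xs) shortSquares (trans squareEnds≡thueMorse eq)
    in p , d , shortSquares-end p∈ ,
       subst (λ j → Agree blockWord (d + m) j (suc p)) (+-assoc (suc p) d m)
         (window⇒agree Fin._≟_ blockWord d (suc p + d) m (suc p) len found)

  square⇒thueMorse : ∀ {p d} → (p , d) ∈ shortSquares →
    Agree blockWord (d + m) (suc p + (d + m)) (suc p) → thueMorse (25 + m) ≡ true
  square⇒thueMorse {p} {d} p∈ agree = trans (sym squareEnds≡thueMorse)
    (any-∈ (squareAt xs) p∈ (agree⇒window Fin._≟_ blockWord d (suc p + d) m (suc p) len
      (subst (λ j → Agree blockWord (d + m) j (suc p)) (sym (+-assoc (suc p) d m)) agree)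
      (fits d (suc p) (≤-trans (≤-trans (≤-reflexive (+-comm d (suc p))) (m≤n+m _ (suc p))) end≤))
      (fits (suc p + d) (suc p) (≤-trans (≤-reflexive (+-comm (suc p + d) (suc p))) end≤))))
    where
    end≤ : suc p + (suc p + d) ≤ 97
    end≤ = ≤-trans (≤-reflexive (shortSquares-end p∈)) (m≤m+n 10 87)

  -- The factor at `j * 16` is one of the eight blocks, so a second occurrence contradicts
  -- `noBlockStarts` unless the offset is a multiple of 16. Then `m` is one as well, since 16
  -- divides 64.
  synchronous : ∀ j → Agree blockWord (j * 16) m 16 → ∃ λ i → m ≡ i * 16
  synchronous j agree = by-cases (synchronized-sound offset xs (holds checkSynchrony refl))
    where
    open ≡-Reasoning
    by-cases : offset % 16 ≡ 0 ⊎ noBlockStarts xs ≡ true → ∃ λ i → m ≡ i * 16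
    by-cases (inj₁ aligned) = offset / 16 + quotient * 4 , (begin
      m                                      ≡⟨ m≡ ⟩
      offset + quotient * 64                 ≡⟨ cong (_+ quotient * 64) (m≡m%n+[m/n]*n offset 16) ⟩
      offset % 16 + offset / 16 * 16 + quotient * 64
        ≡⟨ cong (λ r → r + offset / 16 * 16 + quotient * 64) aligned ⟩
      offset / 16 * 16 + quotient * 64       ≡⟨ cong (offset / 16 * 16 +_) (sym (*-assoc quotient 4 16)) ⟩
      offset / 16 * 16 + quotient * 4 * 16   ≡⟨ sym (*-distribʳ-+ 16 (offset / 16) (quotient * 4)) ⟩
      (offset / 16 + quotient * 4) * 16      ∎)
    by-cases (inj₂ absent) = contradiction
      (trans (cong (λ b → sameLetters 16 b xs) (block≡window j))
             (agree⇒prefixesAgree Fin._≟_ 16 16 len agree ≤-refl (fits 0 16 (m≤m+n 16 81))))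
      (not-true (noBlockStarts-sound xs absent (thueMorse j) (thueMorse (1 + j)) (thueMorse (2 + j))))

-- Squares of long period

shift-agree : ∀ {A : Set ℓ} (w : InfiniteWord A) {i j l} d l′ → d + l′ ≤ l → Agree w i j l →
              Agree w (d + i) (d + j) l′
shift-agree w {i} {j} d l′ d+l′≤l agree k k<l′ = begin
  w (k + (d + i)) ≡⟨ cong w (sym (+-assoc k d i)) ⟩
  w (k + d + i)   ≡⟨ agree (k + d) (≤-trans (≤-reflexive (+-comm (suc k) d))
                                            (≤-trans (+-monoʳ-≤ d k<l′) d+l′≤l)) ⟩
  w (k + d + j)   ≡⟨ cong w (+-assoc k d j) ⟩
  w (k + (d + j)) ∎
  where open ≡-Reasoning

sameTriple : ∀ i j → Agree blockWord (i * 16) (j * 16) 16 →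
  thueMorse i ≡ thueMorse j × thueMorse (1 + i) ≡ thueMorse (1 + j) ×
  thueMorse (2 + i) ≡ thueMorse (2 + j)
sameTriple i j agree = block-injective (thueMorse i) (thueMorse (1 + i)) (thueMorse (2 + i))
                                    (thueMorse j) (thueMorse (1 + j)) (thueMorse (2 + j))
  (trans (block≡window i) (trans (applyUpTo-cong 16 agree) (sym (block≡window j))))

nextMultiple : ∀ m → ∃₂ λ d j → d ≤ 15 × d + m ≡ j * 16
nextMultiple m = d , (m + 15) / 16 , m∸n≤m 15 r , (begin
  15 ∸ r + m               ≡⟨ +-comm (15 ∸ r) m ⟩
  m + (15 ∸ r)             ≡⟨ sym (+-∸-assoc m r≤15) ⟩
  m + 15 ∸ r               ≡⟨ cong (_∸ r) (m≡m%n+[m/n]*n (m + 15) 16) ⟩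
  r + (m + 15) / 16 * 16 ∸ r ≡⟨ m+n∸m≡n r _ ⟩
  (m + 15) / 16 * 16       ∎)
  where
  open ≡-Reasoning
  r = (m + 15) % 16
  d = 15 ∸ r
  r≤15 : r ≤ 15
  r≤15 = ≤-pred (m%n<n (m + 15) 16)

-- Each block records three letters of the Thue-Morse word, so the 1 + r whole blocks inside the
-- first half of the square determine one letter more than the 2 + r that make up a period.
no-aligned-square : ∀ m d j r → d ≤ 15 → d + m ≡ j * 16 →
                    ¬ Agree blockWord m ((2 + r) * 16 + m) ((2 + r) * 16)
no-aligned-square m d j r d≤15 d+m≡ agree = thueMorse-noOverlap (suc r) j overlap-at
  where
  p = (2 + r) * 16
  SameTriple : ℕ → Set
  SameTriple k = thueMorse (k + j) ≡ thueMorse (k + (2 + r + j)) ×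
                 thueMorse (1 + (k + j)) ≡ thueMorse (1 + (k + (2 + r + j))) ×
                 thueMorse (2 + (k + j)) ≡ thueMorse (2 + (k + (2 + r + j)))
  triples : ∀ k → k ≤ r → SameTriple k
  triples k k≤r = sameTriple (k + j) (k + (2 + r + j))
    (subst₂ (λ x y → Agree blockWord x y 16) left right
      (shift-agree blockWord (k * 16 + d) 16 bound agree))
    where
    open ≡-Reasoning
    bound : k * 16 + d + 16 ≤ p
    bound = ≤-trans (≤-reflexive (+-assoc (k * 16) d 16)) (≤-trans
      (+-mono-≤ (*-monoˡ-≤ 16 k≤r) (≤-trans (+-monoˡ-≤ 16 d≤15) (n≤1+n 31)))
      (≤-reflexive (+-comm (r * 16) 32)))
    left : k * 16 + d + m ≡ (k + j) * 16
    left = trans (+-assoc (k * 16) d m)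
      (trans (cong (k * 16 +_) d+m≡) (sym (*-distribʳ-+ 16 k j)))
    right : k * 16 + d + (p + m) ≡ (k + (2 + r + j)) * 16
    right = begin
      k * 16 + d + (p + m)      ≡⟨ +-assoc (k * 16) d (p + m) ⟩
      k * 16 + (d + (p + m))    ≡⟨ cong (k * 16 +_) (x∙yz≈y∙xz d p m) ⟩
      k * 16 + (p + (d + m))    ≡⟨ cong (λ x → k * 16 + (p + x)) d+m≡ ⟩
      k * 16 + (p + j * 16)     ≡⟨ cong (k * 16 +_) (sym (*-distribʳ-+ 16 (2 + r) j)) ⟩
      k * 16 + (2 + r + j) * 16 ≡⟨ sym (*-distribʳ-+ 16 k (2 + r + j)) ⟩
      (k + (2 + r + j)) * 16    ∎
  overlap-at : Agree thueMorse j (2 + r + j) (3 + r)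
  overlap-at k k<3+r with m≤n⇒m<n∨m≡n (≤-pred k<3+r)
  ... | inj₂ refl = proj₂ (proj₂ (triples r ≤-refl))
  ... | inj₁ (s≤s k≤1+r) with m≤n⇒m<n∨m≡n k≤1+r
  ...   | inj₂ refl      = proj₁ (proj₂ (triples r ≤-refl))
  ...   | inj₁ (s≤s k≤r) = proj₁ (triples k k≤r)

-- At most 15 letters precede the first block boundary, so a half of 31 = 15 + 16 letters contains a
-- whole block. Its repetition in the other half must be aligned too, which makes the period a
-- multiple of 16, and at least 32.
no-long-square : ∀ m p → 31 ≤ p → ¬ Agree blockWord m (p + m) p
no-long-square m p 31≤p agree =
  let d , j , d≤15 , d+m≡ = nextMultiple m
      i , p+j*16≡ = Windows.synchronous (windowAt (p + j * 16)) j (aligned d j d≤15 d+m≡)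
  in by-period d j (i ∸ j) d≤15 d+m≡ (period i j p+j*16≡)
  where
  aligned : ∀ d j → d ≤ 15 → d + m ≡ j * 16 → Agree blockWord (j * 16) (p + j * 16) 16
  aligned d j d≤15 d+m≡ = subst₂ (λ x y → Agree blockWord x y 16) d+m≡
    (trans (x∙yz≈y∙xz d p m) (cong (p +_) d+m≡))
    (shift-agree blockWord d 16 (≤-trans (+-monoˡ-≤ 16 d≤15) 31≤p) agree)
  period : ∀ i j → p + j * 16 ≡ i * 16 → p ≡ (i ∸ j) * 16
  period i j eq = trans (sym (m+n∸n≡m p (j * 16)))
    (trans (cong (_∸ j * 16) eq) (sym (*-distribʳ-∸ 16 i j)))
  by-period : ∀ d j q → d ≤ 15 → d + m ≡ j * 16 → p ≢ q * 16
  by-period d j 0 _ _ p≡ = contradiction (≤-trans 31≤p (≤-reflexive p≡)) λ ()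
  by-period d j 1 _ _ p≡ = contradiction (≤-trans 31≤p (≤-reflexive p≡)) (<⇒≱ (m≤m+n 17 14))
  by-period d j (suc (suc r)) d≤15 d+m≡ p≡ = no-aligned-square m d j r d≤15 d+m≡
    (subst (λ p → Agree blockWord m (p + m) p) p≡ agree)

-- The offset is such that the squares required by the first letters of C(w) start within w.
witness : InfiniteWord (Fin 4)
witness n = blockWord (n + 35)

-- A square ends at position x of `blockWord` exactly when t has the letter 1 at x + 16, and 51 = 35
-- + 16.
squareMark : InfiniteWord Bool
squareMark n = thueMorse (n + 51)

reassociate : ∀ k p i s → k + (p + i) + s ≡ k + (p + (i + s))
reassociate k p i s = trans (+-assoc k (p + i) s) (cong (k +_) (+-assoc p i s))

shifted-agree : ∀ {A : Set ℓ} (w : InfiniteWord A) s {i p l} →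
                Agree (λ n → w (n + s)) i (p + i) l → Agree w (i + s) (p + (i + s)) l
shifted-agree w s {i} {p} agree k k<l = trans (cong w (sym (+-assoc k i s)))
  (trans (agree k k<l) (cong w (reassociate k p i s)))

unshifted-agree : ∀ {A : Set ℓ} (w : InfiniteWord A) s {i p l} →
                  Agree w (i + s) (p + (i + s)) l → Agree (λ n → w (n + s)) i (p + i) l
unshifted-agree w s {i} {p} agree k k<l = trans (cong w (+-assoc k i s))
  (trans (agree k k<l) (cong w (sym (reassociate k p i s))))

shifted-noOverlap : ∀ {A : Set ℓ} {w : InfiniteWord A} s → NoOverlap w → NoOverlap (λ n → w (n + s))
shifted-noOverlap {w = w} s free p i agree = free p (i + s) (shifted-agree w s {i} {suc p} agree)

-- The squares of the witness and the letters of t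

square-short : ∀ m p → Agree blockWord m (suc p + m) (suc p) → p < 5
square-short m p agree with p <? 5 | p <? 30
... | yes p<5 | _        = p<5
... | no p≮5  | yes p<30 = contradiction agree (Windows.no-medium-square (windowAt m) p (≮⇒≥ p≮5) p<30)
... | no _    | no p≮30  = contradiction agree (no-long-square m (suc p) (s≤s (≮⇒≥ p≮30)))

blockWord-noOverlap : NoOverlap blockWord
blockWord-noOverlap p m agree = Windows.no-short-overlap (windowAt m) p
  (square-short m p (Agree-≤ {w = blockWord} (n≤1+n (suc p)) agree)) agree

witness-noOverlap : NoOverlap witness
witness-noOverlap = shifted-noOverlap {w = blockWord} 35 blockWord-noOverlap

squareMark-noOverlap : NoOverlap squareMark
squareMark-noOverlap = shifted-noOverlap {w = thueMorse} 51 thueMorse-noOverlap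

-- A square has period at most 5, so it lies in the window of ten letters with the same end. For
-- small `n` this window starts before `witness` but still within `blockWord`, so no case
-- distinction arises.
square⇒mark : ∀ n → SquareEndsAt witness n → squareMark n ≡ true
square⇒mark n (p , i , end , agree) = by-period p i n (square-short (i + 35) p agree′) end agree′
  where
  agree′ : Agree blockWord (i + 35) (suc p + (i + 35)) (suc p)
  agree′ = shifted-agree blockWord 35 {i} {suc p} agree
  realign : ∀ {d p} i n → (p , d) ∈ shortSquares → n + d ≡ 9 + i →
    Agree blockWord (i + 35) (suc p + (i + 35)) (suc p) → thueMorse (n + 51) ≡ true
  realign {d} {p} i n p∈ n+d≡ agree = subst (λ m → thueMorse m ≡ true) (x∙yz≈y∙xz 25 n 26)
    (Windows.square⇒thueMorse (windowAt (n + 26)) p∈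
      (subst (λ m → Agree blockWord m (suc p + m) (suc p)) (sym start) agree))
    where
    start : d + (n + 26) ≡ i + 35
    start = trans (sym (+-assoc d n 26)) (trans (cong (_+ 26) (trans (+-comm d n) n+d≡))
      (trans (cong (_+ 26) (+-comm 9 i)) (+-assoc i 9 26)))
  by-period : ∀ p i n → p < 5 → suc p + (suc p + i) ≡ suc n →
    Agree blockWord (i + 35) (suc p + (i + 35)) (suc p) → thueMorse (n + 51) ≡ true
  by-period p i n p<5 end = realign i n p∈ (suc-injective (begin
    suc n + d                ≡⟨ cong (_+ d) (sym end) ⟩
    suc p + (suc p + i) + d  ≡⟨ cong (_+ d) (sym (+-assoc (suc p) (suc p) i)) ⟩
    suc p + suc p + i + d    ≡⟨ xy∙z≈xz∙y (suc p + suc p) i d ⟩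
    suc p + suc p + d + i    ≡⟨ cong (_+ i) (trans (+-assoc (suc p) (suc p) d)
                                                   (shortSquares-end p∈)) ⟩
    10 + i                   ∎))
    where
    open ≡-Reasoning
    d = proj₁ (shortSquare p p<5)
    p∈ = proj₂ (shortSquare p p<5)

opaque
  unfolding thueMorse blockWord

  -- For these `n` the window of ten letters reaches back beyond the start of `witness`, and a
  -- square found there could start too early. The marks are at 1, 4, 5 and 8, where squares of
  -- periods 1, 1, 3 and 1 fit.
  early-square : ∀ n → n < 9 → squareMark n ≡ true → SquareEndsAt witness n
  early-square 0 _ ()
  early-square 1 _ _ = 0 , 0 , refl , λ { zero _ → refl ; (suc _) (s<s ()) }
  early-square 2 _ ()
  early-square 3 _ ()
  early-square 4 _ _ = 0 , 3 , refl , λ { zero _ → refl ; (suc _) (s<s ()) }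
  early-square 5 _ _ = 2 , 0 , refl , λ where
    zero                _ → refl
    (suc zero)          _ → refl
    (suc (suc zero))    _ → refl
    (suc (suc (suc _))) (s<s (s<s (s<s ())))
  early-square 6 _ ()
  early-square 7 _ ()
  early-square 8 _ _ = 0 , 7 , refl , λ { zero _ → refl ; (suc _) (s<s ()) }
  early-square (suc (suc (suc (suc (suc (suc (suc (suc (suc n)))))))))
    (s≤s (s≤s (s≤s (s≤s (s≤s (s≤s (s≤s (s≤s (s≤s ()))))))))) _

mark⇒square : ∀ n → squareMark n ≡ true → SquareEndsAt witness n
mark⇒square n marked with n <? 9
... | yes n<9 = early-square n n<9 marked
... | no n≮9 with n′ , refl ← m≤n⇒∃[o]m+o≡n (≮⇒≥ n≮9) =
  -- The window starts at position `n′ + 35` of `blockWord`, which is letter `n′` of `witness`, so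
  -- the square found lies inside `witness`.
  let p , d , end , agree = Windows.thueMorse⇒square (windowAt (9 + n′ + 26))
        (subst (λ m → thueMorse m ≡ true) (sym (x∙yz≈y∙xz 25 (9 + n′) 26)) marked)
  in p , d + n′ , final p d end , unshifted-agree blockWord 35 {d + n′} {suc p}
       (subst (λ m → Agree blockWord m (suc p + m) (suc p)) (start d) agree)
  where
  final : ∀ p d → suc p + (suc p + d) ≡ 10 → suc p + (suc p + (d + n′)) ≡ 10 + n′
  final p d end = trans (cong (suc p +_) (sym (+-assoc (suc p) d n′)))
    (trans (sym (+-assoc (suc p) (suc p + d) n′)) (cong (_+ n′) end))
  start : ∀ d → d + (9 + n′ + 26) ≡ d + n′ + 35
  start d = trans (cong (λ x → d + (x + 26)) (+-comm 9 n′))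
    (trans (cong (d +_) (+-assoc n′ 9 26)) (sym (+-assoc d n′ 35)))

squareMark-reflects : ∀ n → Reflects (SquareEndsAt witness n) (squareMark n)
squareMark-reflects n with squareMark n | square⇒mark n | mark⇒square n
... | true  | _      | exists = ofʸ (exists refl)
... | false | marked | _      = ofⁿ λ sq → contradiction (marked sq) λ ()

C-witness-noOverlap : NoOverlap (C Fin._≟_ witness)
C-witness-noOverlap p i agree = squareMark-noOverlap p i λ k k<l →
  value-injective _ _ (trans (sym (C≡ (k + i))) (trans (agree k k<l) (C≡ (k + (suc p + i)))))
  where
  C≡ : ∀ n → C Fin._≟_ witness n ≡ (if squareMark n then 2 else 1)
  C≡ n = let b , reflects , eq = C-reflects Fin._≟_ witness witness-noOverlap n
         in trans eq (cong (λ b → if b then 2 else 1) (det reflects (squareMark-reflects n)))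
  value-injective : ∀ x y → (if x then 2 else 1) ≡ (if y then 2 else 1) → x ≡ y
  value-injective false false _ = refl
  value-injective true  true  _ = refl

corollary13 : (∃ λ (w : InfiniteWord (Fin 4)) → OverlapFree w × OverlapFree (C _≟_ w))
    × (∀ (k : ℕ) → k < 4 →
    ¬ (∃ λ (w : InfiniteWord (Fin k)) → OverlapFree w × OverlapFree (C _≟_ w)))
corollary13 =
  (witness , noOverlap⇒overlapFree witness witness-noOverlap
           , noOverlap⇒overlapFree (C _≟_ witness) C-witness-noOverlap)
  , no-word-below-four
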